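{- Let $q$ be a prime power and let $U=(X,B)$ be an abstract unital of order $q$ (i.e. a $2$-$(q^3+1,q+1,1)$ design) which is embedded in the Desarguesian projective plane $\mathsf{PG}(2,q^2)$. Then $U$ is strongly full point regular: for any two disjoint blocks $b_1,b_2\in B$, (a) there is a block $c\in B$ with $c\cap b_1=c\cap b_2=\emptyset$ and $F_U(b_1,b_2)\subseteq c$, and (b) $\mathrm{Persp}_{b_2}(b_1)$ is a cyclic semi-regular permutation group on $b_1$.
   Context: An abstract unital $U=(X,B)$ is embedded in a projective plane $\Pi$ if $X$ is a set of points of $\Pi$ and every block $b\in B$ is of the form $X\cap\ell$ for some line $\ell$ of $\Pi$. For blocks $b_1,b_2$, a point $P\in X$ is a full point with respect to $(b_1,b_2)$ if $P\notin b_1\cup b_2$ and for every $Q\in b_1$ the block through $P$ and $Q$ meets $b_2$; then the map $\pi_{b_1,P,b_2}:b_1\to b_2$ sending $Q$ to the intersection point of the block $PQ$ with $b_2$ is a bijection (the perspectivity with center $P$). $F_U(b_1,b_2)$ denotes the set of full points w.r.t. $(b_1,b_2)$. The group of perspectivities is $\mathrm{Persp}_{b_2}(b_1)=\langle \pi_{b_1,P,b_2}\pi_{b_2,Q,b_1} \mid P,Q\in F_U(b_1,b_2)\rangle$, a permutation group on $b_1$ (generated by the empty set, hence trivial, if $F_U(b_1,b_2)=\emptyset$). A permutation group is semi-regular if all point stabilizers are trivial. -}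

module Defs where

open import Level using (0ℓ)
open import Algebra.Bundles using (CommutativeRing)
open import Data.Nat using (ℕ; suc; _^_) renaming (_+_ to _+ℕ_)
open import Data.Nat.Primality using (Prime)
open import Data.Fin using (Fin)
open import Data.Bool using (Bool; true)
open import Data.List using (List; []; _∷_)
open import Data.Product using (Σ; ∃; ∃₂; _×_; _,_; proj₁)
open import Data.Empty using (⊥)
open import Relation.Binary.PropositionalEquality using (_≡_)
open import Relation.Nullary using (¬_)
open import Function.Bundles using (_↔_)

IsPrimePower : ℕ → Set
IsPrimePower q = ∃₂ λ p k → Prime p × q ≡ p ^ suc k

record IsFiniteFieldOfOrder (n : ℕ) (R : CommutativeRing 0ℓ 0ℓ) : Set where
  open CommutativeRing R
  field
    0≉1       : ¬ (0# ≈ 1#)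
    inverse   : ∀ x → ¬ (x ≈ 0#) → ∃ λ y → x * y ≈ 1#
    enum      : Fin n → Carrier
    enum-inj  : ∀ i j → enum i ≈ enum j → i ≡ j
    enum-surj : ∀ x → ∃ λ i → enum i ≈ x

-- The Desarguesian projective plane PG(2,F) over a field F:
-- points and lines are nonzero vectors of F³ up to nonzero scalars,
-- the point (x,y,z) lies on the line [a,b,c] iff xa + yb + zc = 0.

module ProjectivePlane (R : CommutativeRing 0ℓ 0ℓ) where
  open CommutativeRing R

  Vec3 : Set
  Vec3 = Carrier × Carrier × Carrier

  NonZero3 : Vec3 → Set
  NonZero3 (x , y , z) = ¬ (x ≈ 0# × y ≈ 0# × z ≈ 0#)

  Proportional : Vec3 → Vec3 → Set
  Proportional (x , y , z) (x' , y' , z') =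
    ∃ λ c → ¬ (c ≈ 0#) × x' ≈ c * x × y' ≈ c * y × z' ≈ c * z

  Incident : Vec3 → Vec3 → Set
  Incident (x , y , z) (a , b , c) = (x * a + y * b) + z * c ≈ 0#

-- Abstract unital of order q: a 2-(q³+1, q+1, 1) design.
-- Incidence is Boolean (so membership is proof-irrelevant).

record AbstractUnital (q : ℕ) : Set₁ where
  field
    Point Block : Set
    inc         : Point → Block → Bool

  _∈_ : Point → Block → Set
  P ∈ b = inc P b ≡ true

  field
    points    : Fin (q ^ 3 +ℕ 1) ↔ Point
    blockSize : ∀ b → Fin (q +ℕ 1) ↔ Σ Point (λ P → P ∈ b)
    join      : ∀ P Q → ¬ (P ≡ Q) →
                ∃ λ b → P ∈ b × Q ∈ b × (∀ b' → P ∈ b' → Q ∈ b' → b' ≡ b)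

module _ {q : ℕ} (U : AbstractUnital q) (R : CommutativeRing 0ℓ 0ℓ) where
  open AbstractUnital U
  open ProjectivePlane R

  record EmbeddedIn : Set where
    field
      coord     : Point → Vec3
      coord-nz  : ∀ P → NonZero3 (coord P)
      coord-inj : ∀ P Q → Proportional (coord P) (coord Q) → P ≡ Q
      blockLine : ∀ b → ∃ λ ℓ → NonZero3 ℓ ×
                    (∀ P → (P ∈ b → Incident (coord P) ℓ) ×
                           (Incident (coord P) ℓ → P ∈ b))

-- Full points, perspectivities and the group Persp_{b2}(b1).
-- Permutations of b1 are represented as relations on points (graphs);
-- the perspectivity π_{b1,P,b2} has graph
--   { (x,z) | x ∈ b1, z ∈ b2, z on the block through P and x }.

module UnitalTheory {q : ℕ} (U : AbstractUnital q) where
  open AbstractUnital U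

  Disjoint : Block → Block → Set
  Disjoint b c = ∀ P → P ∈ b → P ∈ c → ⊥

  -- P is a full point w.r.t. (b1,b2); "the block through P and Q" is
  -- expressed as "a block containing P and Q" (it is unique since P ≠ Q).
  Full : Block → Block → Point → Set
  Full b1 b2 P = ¬ (P ∈ b1) × ¬ (P ∈ b2) ×
    (∀ Q → Q ∈ b1 → ∃ λ c → P ∈ c × Q ∈ c × (∃ λ R → R ∈ b2 × R ∈ c))

  Rel : Set₁
  Rel = Point → Point → Set

  PerspMap : Block → Point → Block → Rel
  PerspMap a P b x z = x ∈ a × z ∈ b × ∃ λ c → P ∈ c × x ∈ c × z ∈ c

  IdOn : Block → Rel
  IdOn b1 x y = x ∈ b1 × x ≡ y

  _⨾_ : Rel → Rel → Rel
  (f ⨾ g) x y = ∃ λ w → f x w × g w y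

  _≐_ : Rel → Rel → Set
  f ≐ g = ∀ x y → (f x y → g x y) × (g x y → f x y)

  module _ (b1 b2 : Block) where

    FullPt : Set
    FullPt = Σ Point (Full b1 b2)

    Gen : FullPt → FullPt → Rel
    Gen (P , _) (Q , _) = PerspMap b1 P b2 ⨾ PerspMap b2 Q b1

    -- words in the generators; since Gen P Q has inverse Gen Q P, the
    -- elements ⟦ w ⟧ are exactly the elements of Persp_{b2}(b1)
    Word : Set
    Word = List (FullPt × FullPt)

    ⟦_⟧ : Word → Rel
    ⟦ [] ⟧          = IdOn b1
    ⟦ (P , Q) ∷ w ⟧ = Gen P Q ⨾ ⟦ w ⟧

    _^^_ : Rel → ℕ → Rel
    g ^^ 0       = IdOn b1
    g ^^ (suc n) = g ⨾ (g ^^ n)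

    PerspCyclic : Set
    PerspCyclic = ∃ λ g → ∀ w → ∃ λ n → ⟦ w ⟧ ≐ (⟦ g ⟧ ^^ n)

    PerspSemiRegular : Set
    PerspSemiRegular = ∀ w x → x ∈ b1 → ⟦ w ⟧ x x → ⟦ w ⟧ ≐ IdOn b1

  StronglyFullPointRegular : Set
  StronglyFullPointRegular = ∀ b1 b2 → Disjoint b1 b2 →
    (∃ λ c → Disjoint c b1 × Disjoint c b2 × (∀ P → Full b1 b2 P → P ∈ c))
    × PerspCyclic b1 b2 × PerspSemiRegular b1 b2

{-# OPTIONS --safe #-}

-- Let N be the intersection of the lines carrying b₁ and b₂, and choose
-- coordinates α, β, γ with b₁ on α = 0 and b₂ on β = 0. Off N, the lines have
-- affine coordinates X = γ/β and Y = γ/α, and three points P, x ∈ b₁, z ∈ b₂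
-- are collinear exactly when α(P) Y(z) + β(P) X(x) = γ(P). For a full point P
-- this holds for the q + 1 pairs (x , π(x)); summing, with q = 0 in F, gives
-- α(P) σ₂ + β(P) σ₁ = γ(P) for the coordinate sums σ₁, σ₂ of b₁ and b₂. So the
-- full points lie on one line, and in the shifted coordinates ξ = X - σ₁,
-- η = Y - σ₂ every perspectivity is a multiplication η = s ξ. Hence
-- Persp is a finitely generated group of multiplications on F, so cyclic. Were
-- ξ = 0 a point of b₁, then s^q = 1 = s^(q²-1) and s = 1; this yields
-- semi-regularity and shows that two full points span a block missing b₁ and
-- b₂. With at most one full point such a block is found by counting.
module Submission where

-- Since q = 0 in `F`, the sum of q + 1 coordinates is also their mean: σ₁ and σ₂ are the
-- barycentres of the two blocks, with N as the point at infinity of both lines. A perspectivity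
-- with a full centre is an affine map from X to Y and must carry one barycentre to the other. So
-- every full point lies on the line through the two barycentres, and with these as origins the
-- affine maps become linear. That line meets the carrier of `b₁` exactly in ξ = 0, which is why
-- this one point matters both for semi-regularity and for disjointness. Cyclicity asks for a word
-- as generator, so an element of maximal order is constructed explicitly. Blocks carry no
-- enumeration, so a block with a required property is searched for among the joins of points. The
-- count compares the 2(q + 1) points to be avoided with the q² blocks through a point and works for
-- q ≥ 3 only; for q = 2 the unital is the affine plane of order 3, and uniqueness of parallels
-- takes over.

open import Defs
open import Level using (0ℓ)
open import Algebra.Bundles using (CommutativeRing; RawRing)
import Algebra.Properties.AbelianGroup
import Algebra.Properties.CommutativeMonoid.Sum
import Algebra.Properties.CommutativeSemigroup
import Algebra.Properties.CommutativeSemiring.Exp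
import Algebra.Properties.Ring
import Algebra.Properties.Semiring.Exp
import Algebra.Properties.Semiring.Mult
import Algebra.Properties.Semiring.Sum
import Algebra.Solver.Ring
import Algebra.Solver.Ring.AlmostCommutativeRing
open import Axiom.UniquenessOfIdentityProofs using (module Decidable⇒UIP)
open import Data.Bool using (true)
import Data.Bool.Properties as Bool
open import Data.Empty using (⊥; ⊥-elim)
open import Data.Fin as Fin using (Fin; zero; suc; toℕ; fromℕ<; punchIn; punchOut; combine; remQuot; splitAt)
open import Data.Fin.Permutation using (Permutation′; permutation)
open import Data.Fin.Properties using
  (any?; all?; ¬∀⟶∃¬; pigeonhole; injective⇒≤; punchIn-injective; punchInᵢ≢i; punchIn-punchOut;
   punchOut-injective; combine-remQuot; remQuot-combine; splitAt-↑ˡ; splitAt-↑ʳ; suc-injective;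
   0≢1+n; toℕ<n; toℕ-injective; toℕ-fromℕ<) renaming (_≟_ to _≟ᶠ_)
open import Data.List using (List; []; _∷_; _++_)
open import Data.List.Relation.Unary.All using (All; []; _∷_)
open import Data.Maybe using (Maybe; just; nothing)
open import Data.Nat as ℕ using (ℕ; zero; suc; NonZero; z≤n; s≤s)
open import Data.Nat.Coprimality as Coprimality using (Coprime; coprime-divisor)
open import Data.Nat.Divisibility using
  (_∣_; _∤_; _∣?_; divides; ∣⇒≤; 1∣_; ∣-trans; n∣m*n; m∣m*n; m%n≡0⇒n∣m; *-cancelˡ-∣; *-monoʳ-∣)
open import Data.Nat.DivMod using (_%_; _/_; m≡m%n+[m/n]*n; m%n<n)
open import Data.Nat.ListAction using (product)
open import Data.Nat.Primality using
  (Prime; prime⇒irreducible; prime⇒nonZero; prime⇒nonTrivial; euclidsLemma; ¬prime[1])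
open import Data.Nat.Primality.Factorisation using (factorise; module PrimeFactorisation)
import Data.Nat.Properties as ℕₚ
open import Data.Product using (Σ; ∃; _×_; _,_; proj₁; proj₂; uncurry)
open import Data.Product.Properties using (Σ-≡,≡→≡)
open import Data.Sum using (_⊎_; inj₁; inj₂; [_,_]′)
open import Data.Vec using (Vec; []; _∷_; replicate)
open import Function using (_∘_)
open import Function.Bundles using (_↔_; Inverse)
open import Function.Definitions using (Injective)
open import Relation.Binary.Definitions using (tri<; tri≈; tri>)
open import Relation.Binary.PropositionalEquality as ≡ using (_≡_; _≢_)
import Relation.Binary.Reasoning.Setoid
open import Relation.Nullary using (¬_; Dec; yes; no; contradiction)
open import Relation.Nullary.Decidable using (map′; ¬?; _×-dec_)


-- A ring solver whose coefficients are integers, presented as formal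
-- differences (a , b) of naturals so that the morphism into R is easy.
module IntegerSolver (R : CommutativeRing 0ℓ 0ℓ) where
  open CommutativeRing R
  open Algebra.Properties.Semiring.Mult semiring using (×-homo-+; ×1-homo-*; ×-congˡ) renaming (_×_ to _·_)
  open Algebra.Solver.Ring.AlmostCommutativeRing using (fromCommutativeRing; _-Raw-AlmostCommutative⟶_)
  open Relation.Binary.Reasoning.Setoid setoid
  open Algebra.Properties.Ring ring using (-‿distribˡ-*; -‿distribʳ-*; -0#≈0#; -‿involutive)
  open Algebra.Properties.AbelianGroup +-abelianGroup using (⁻¹-∙-comm)
  open Algebra.Properties.CommutativeSemigroup +-commutativeSemigroup using (interchange)

  private
    differences : RawRing 0ℓ 0ℓ
    differences = record
      { Carrier = ℕ × ℕ ; _≈_ = _≡_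
      ; _+_ = λ (a , b) (c , d) → a ℕ.+ c , b ℕ.+ d
      ; _*_ = λ (a , b) (c , d) → a ℕ.* c ℕ.+ b ℕ.* d , a ℕ.* d ℕ.+ b ℕ.* c
      ; -_ = λ (a , b) → b , a
      ; 0# = 0 , 0 ; 1# = 1 , 0 }

    +-lemma : ∀ a b c d → (a + c) - (b + d) ≈ (a - b) + (c - d)
    +-lemma a b c d = trans (+-congˡ (sym (⁻¹-∙-comm b d))) (interchange a c (- b) (- d))

    neg*neg : ∀ b d → - b * - d ≈ b * d
    neg*neg b d = begin
      - b * - d    ≈⟨ -‿distribˡ-* b (- d) ⟨
      - (b * - d)  ≈⟨ -‿cong (-‿distribʳ-* b d) ⟨
      - - (b * d)  ≈⟨ -‿involutive (b * d) ⟩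
      b * d        ∎

    *-lemma : ∀ a b c d → (a * c + b * d) - (a * d + b * c) ≈ (a - b) * (c - d)
    *-lemma a b c d = begin
      (a * c + b * d) - (a * d + b * c)          ≈⟨ +-lemma _ _ _ _ ⟩
      (a * c - a * d) + (b * d - b * c)          ≈⟨ +-congˡ (+-comm _ _) ⟩
      (a * c - a * d) + (- (b * c) + b * d)      ≈⟨ +-cong (+-congˡ (-‿distribʳ-* a d)) (+-cong (-‿distribˡ-* b c) (sym (neg*neg b d))) ⟩
      (a * c + a * - d) + (- b * c + - b * - d)  ≈⟨ +-cong (distribˡ a c (- d)) (distribˡ (- b) c (- d)) ⟨
      a * (c - d) + - b * (c - d)                ≈⟨ distribʳ (c - d) a (- b) ⟨
      (a - b) * (c - d)                          ∎

    neg-lemma : ∀ a b → b - a ≈ - (a - b)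
    neg-lemma a b = begin
      b - a        ≈⟨ +-comm b (- a) ⟩
      - a + b      ≈⟨ +-congˡ (-‿involutive b) ⟨
      - a - - b    ≈⟨ ⁻¹-∙-comm a (- b) ⟩
      - (a - b)    ∎

    ⟦_⟧ : ℕ × ℕ → Carrier
    ⟦ a , b ⟧ = a · 1# - b · 1#

    morphism : differences -Raw-AlmostCommutative⟶ fromCommutativeRing R
    morphism = record
      { ⟦_⟧ = ⟦_⟧
      ; +-homo = λ (a , b) (c , d) → trans
          (+-cong (×-homo-+ 1# a c) (-‿cong (×-homo-+ 1# b d))) (+-lemma _ _ _ _)
      ; *-homo = λ (a , b) (c , d) → trans
          (+-cong (trans (×-homo-+ 1# (a ℕ.* c) (b ℕ.* d)) (+-cong (×1-homo-* a c) (×1-homo-* b d)))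
            (-‿cong (trans (×-homo-+ 1# (a ℕ.* d) (b ℕ.* c)) (+-cong (×1-homo-* a d) (×1-homo-* b c)))))
          (*-lemma _ _ _ _)
      ; -‿homo = λ (a , b) → neg-lemma _ _
      ; 0-homo = -‿inverseʳ 0#
      ; 1-homo = trans (+-cong (+-identityʳ 1#) -0#≈0#) (+-identityʳ 1#) }

    difference≟ : ∀ i j → Maybe (⟦ i ⟧ ≈ ⟦ j ⟧)
    difference≟ (a , b) (c , d) with (a ℕ.+ d) ℕₚ.≟ (b ℕ.+ c)
    ... | no _ = nothing
    ... | yes eq = just (begin
      a · 1# - b · 1#                          ≈⟨ +-identityʳ _ ⟨
      (a · 1# - b · 1#) + 0#                   ≈⟨ +-congˡ (-‿inverseʳ (d · 1#)) ⟨
      (a · 1# - b · 1#) + (d · 1# - d · 1#)    ≈⟨ +-lemma _ _ _ _ ⟨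
      (a · 1# + d · 1#) - (b · 1# + d · 1#)    ≈⟨ +-congʳ (trans (sym (×-homo-+ 1# a d)) (trans (×-congˡ eq) (×-homo-+ 1# b c))) ⟩
      (b · 1# + c · 1#) - (b · 1# + d · 1#)    ≈⟨ +-lemma _ _ _ _ ⟩
      (b · 1# - b · 1#) + (c · 1# - d · 1#)    ≈⟨ +-congʳ (-‿inverseʳ (b · 1#)) ⟩
      0# + (c · 1# - d · 1#)                   ≈⟨ +-identityˡ _ ⟩
      c · 1# - d · 1#                          ∎)

  open Algebra.Solver.Ring differences (fromCommutativeRing R) morphism difference≟ public
    using (solve; _:=_; _:+_; _:*_; _:-_; :-_)

-- Arithmetic and finite sets

prime∤⇒coprime : ∀ {p n} → Prime p → p ∤ n → Coprime p n
prime∤⇒coprime pr p∤n (d∣p , d∣n) with prime⇒irreducible pr d∣p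
... | inj₁ d≡1 = d≡1
... | inj₂ ≡.refl = contradiction d∣n p∤n

coprime-* : ∀ {a b c} → Coprime a c → Coprime b c → Coprime (a ℕ.* b) c
coprime-* {a} cop-a cop-b {d} (d∣ab , d∣c) = cop-b (coprime-divisor cop-da d∣ab , d∣c)
  where
  cop-da : Coprime d a
  cop-da (e∣d , e∣a) = cop-a (e∣a , ∣-trans e∣d d∣c)

coprime-^ : ∀ {a c} k → Coprime a c → Coprime (a ℕ.^ k) c
coprime-^ zero    cop = Coprimality.1-coprimeTo _
coprime-^ (suc k) cop = coprime-* cop (coprime-^ k cop)

-- Some prime `p` occurs in `m` with a higher exponent than in `n`: its exact power in `n` is
-- `p ^ b`, while `p ^ suc b` still divides `m`. The induction cancels prime factors of `m` from
-- both numbers until one fails to divide `n`; on the way back a cancelled prime either raises the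
-- exponent `b` or joins the cofactors.
∤⇒prime-power : ∀ {m n} → .{{NonZero m}} → m ∤ n →
  ∃ λ p → ∃ λ b → ∃ λ n′ → ∃ λ m′ → Prime p × p ∤ n′ × n ≡ p ℕ.^ b ℕ.* n′ × m ≡ m′ ℕ.* p ℕ.^ suc b
∤⇒prime-power {m} m∤n = ≡.subst Claim (≡.sym fac.isFactorisation) (go fac.factors fac.factorsPrime _) m∤n
  where
  module fac = PrimeFactorisation (factorise m)
  Result : ℕ → ℕ → Set
  Result m n = ∃ λ p → ∃ λ b → ∃ λ n′ → ∃ λ m′ →
    Prime p × p ∤ n′ × n ≡ p ℕ.^ b ℕ.* n′ × m ≡ m′ ℕ.* p ℕ.^ suc b
  Claim : ℕ → Set
  Claim m = m ∤ _ → Result m _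
  go : ∀ ps → All Prime ps → ∀ n → product ps ∤ n → Result (product ps) n
  go [] [] n 1∤n = contradiction (1∣ n) 1∤n
  go (p ∷ ps) (pr ∷ prs) n m∤n with p ∣? n
  ... | no p∤n = p , 0 , n , product ps , pr , p∤n , ≡.sym (ℕₚ.*-identityˡ n) ,
        ≡.trans (ℕₚ.*-comm p (product ps)) (≡.cong (product ps ℕ.*_) (≡.sym (ℕₚ.*-identityʳ p)))
  ... | yes (divides n₁ ≡.refl)
      with go ps prs n₁ (λ d → m∤n (≡.subst (p ℕ.* product ps ∣_) (ℕₚ.*-comm p n₁) (*-monoʳ-∣ p d)))
  ... | r , b , n′ , m′ , r-pr , r∤n′ , ≡.refl , eq with r ℕₚ.≟ p
  ... | yes ≡.refl = p , suc b , n′ , m′ , r-pr , r∤n′ ,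
        ≡.trans (ℕₚ.*-comm (p ℕ.^ b ℕ.* n′) p) (≡.sym (ℕₚ.*-assoc p (p ℕ.^ b) n′)) ,
        ≡.trans (≡.cong (p ℕ.*_) eq) (x∙yz≈y∙xz p m′ (p ℕ.* p ℕ.^ b))
    where open import Algebra.Properties.CommutativeSemigroup ℕₚ.*-commutativeSemigroup
  ... | no r≢p = r , b , n′ ℕ.* p , p ℕ.* m′ , r-pr , r∤n′p , ℕₚ.*-assoc (r ℕ.^ b) n′ p ,
        ≡.trans (≡.cong (p ℕ.*_) eq) (≡.sym (ℕₚ.*-assoc p m′ (r ℕ.^ suc b)))
    where
    r∤n′p : r ∤ n′ ℕ.* p
    r∤n′p d with euclidsLemma n′ p r-pr d
    ... | inj₁ r∣n′ = r∤n′ r∣n′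
    ... | inj₂ r∣p with prime⇒irreducible pr r∣p
    ... | inj₁ ≡.refl = ¬prime[1] r-pr
    ... | inj₂ r≡p = r≢p r≡p

injective⇒surjective : ∀ {n} (f : Fin n → Fin n) → Injective _≡_ _≡_ f → ∀ j → ∃ λ i → f i ≡ j
injective⇒surjective {suc n} f f-inj j with any? (λ i → f i ≟ᶠ j)
... | yes hit = hit
... | no miss = contradiction
      (injective⇒≤ {f = λ i → Fin.punchOut {i = j} {j = f i} (λ eq → miss (i , ≡.sym eq))}
        (λ {i} {k} eq → f-inj (punchOut-injective (λ eq′ → miss (i , ≡.sym eq′)) (λ eq′ → miss (k , ≡.sym eq′)) eq)))
      ℕₚ.1+n≰n

injective⇒permutation : ∀ {n} (f : Fin n → Fin n) → Injective _≡_ _≡_ f → Permutation′ n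
injective⇒permutation f f-inj = permutation f (λ j → proj₁ (surj j)) (λ j → proj₂ (surj j))
    (λ i → f-inj (proj₂ (surj (f i))))
  where
  surj = injective⇒surjective f f-inj

coprime-∣* : ∀ {a b k} → Coprime a b → a ∣ k → b ∣ k → a ℕ.* b ∣ k
coprime-∣* {a} {b} cop (divides l ≡.refl) b∣la =
  ≡.subst (a ℕ.* b ∣_) (ℕₚ.*-comm a l) (*-monoʳ-∣ a (coprime-divisor (Coprimality.sym cop)
    (≡.subst (b ∣_) (ℕₚ.*-comm l a) b∣la)))

-- Finite fields

module FiniteField {n : ℕ} (F : CommutativeRing 0ℓ 0ℓ) (finite : IsFiniteFieldOfOrder n F) where
  open CommutativeRing F hiding (zero)
  open IsFiniteFieldOfOrder finite
  open IntegerSolver F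
  open Algebra.Properties.Semiring.Exp semiring public using (_^_; ^-congˡ; ^-congʳ; ^-homo-*; ^-assocʳ)
  open Algebra.Properties.CommutativeSemiring.Exp commutativeSemiring using (^-distrib-*)
  open Algebra.Properties.Semiring.Mult semiring using (×1-homo-*; ×-assoc-*; ×-congʳ) renaming (_×_ to _·_)
  open Algebra.Properties.Ring ring using (+-cancelˡ; x∙y⁻¹≈ε⇒x≈y)
  private
    module Sum = Algebra.Properties.CommutativeMonoid.Sum +-commutativeMonoid
    module Prod = Algebra.Properties.CommutativeMonoid.Sum *-commutativeMonoid
  open Relation.Binary.Reasoning.Setoid setoid

  index : Carrier → Fin n
  index x = proj₁ (enum-surj x)

  enum-index : ∀ x → enum (index x) ≈ x
  enum-index x = proj₂ (enum-surj x)

  index-injective : ∀ {x y} → index x ≡ index y → x ≈ y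
  index-injective {x} {y} eq = trans (sym (enum-index x)) (trans (reflexive (≡.cong enum eq)) (enum-index y))

  infix 4 _≟_
  _≟_ : ∀ x y → Dec (x ≈ y)
  x ≟ y = map′ index-injective
    (λ x≈y → enum-inj _ _ (trans (enum-index x) (trans x≈y (sym (enum-index y)))))
    (index x ≟ᶠ index y)

  *-cancelˡ : ∀ {x y z} → ¬ x ≈ 0# → x * y ≈ x * z → y ≈ z
  *-cancelˡ {x} {y} {z} x≉0 xy≈xz with inverse x x≉0
  ... | x⁻¹ , xx⁻¹≈1 = trans (sym (restore y)) (trans (*-congˡ xy≈xz) (restore z))
    where
    restore : ∀ t → x⁻¹ * (x * t) ≈ t
    restore t = begin
      x⁻¹ * (x * t) ≈⟨ *-assoc x⁻¹ x t ⟨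
      x⁻¹ * x * t   ≈⟨ *-congʳ (trans (*-comm x⁻¹ x) xx⁻¹≈1) ⟩
      1# * t        ≈⟨ *-identityˡ t ⟩
      t             ∎

  x*y≈0⇒y≈0 : ∀ {x y} → ¬ x ≈ 0# → x * y ≈ 0# → y ≈ 0#
  x*y≈0⇒y≈0 {x} x≉0 xy≈0 = *-cancelˡ x≉0 (trans xy≈0 (sym (zeroʳ x)))

  *-≉0 : ∀ {x y} → ¬ x ≈ 0# → ¬ y ≈ 0# → ¬ x * y ≈ 0#
  *-≉0 x≉0 y≉0 xy≈0 = y≉0 (x*y≈0⇒y≈0 x≉0 xy≈0)

  ^-≉0 : ∀ {x} k → ¬ x ≈ 0# → ¬ x ^ k ≈ 0#
  ^-≉0 zero    x≉0 1≈0 = 0≉1 (sym 1≈0)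
  ^-≉0 (suc k) x≉0     = *-≉0 x≉0 (^-≉0 k x≉0)

  infix 9 _⁻¹
  -- Made total by sending 0 to 0, so that affine coordinates and slopes are functions of a point
  -- alone and can be summed over a block without proofs of nonvanishing.
  _⁻¹ : Carrier → Carrier
  x ⁻¹ with x ≟ 0#
  ... | yes _   = 0#
  ... | no  x≉0 = proj₁ (inverse x x≉0)

  ⁻¹-inverseʳ : ∀ {x} → ¬ x ≈ 0# → x * x ⁻¹ ≈ 1#
  ⁻¹-inverseʳ {x} x≉0 with x ≟ 0#
  ... | yes x≈0  = contradiction x≈0 x≉0
  ... | no  x≉0′ = proj₂ (inverse x x≉0′)

  ⁻¹-≉0 : ∀ {x} → ¬ x ≈ 0# → ¬ x ⁻¹ ≈ 0#
  ⁻¹-≉0 {x} x≉0 x⁻¹≈0 = 0≉1 (trans (sym (zeroʳ x)) (trans (*-congˡ (sym x⁻¹≈0)) (⁻¹-inverseʳ x≉0)))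

  1^k≈1 : ∀ k → 1# ^ k ≈ 1#
  1^k≈1 zero    = refl
  1^k≈1 (suc k) = trans (*-identityˡ _) (1^k≈1 k)

  -- Adding 1 permutes F, so ΣF = ΣF + n·1.
  order·1≈0 : n · 1# ≈ 0#
  order·1≈0 = +-cancelˡ (Sum.sum enum) _ _ (begin
    Sum.sum enum + n · 1#                       ≈⟨ +-congˡ (Sum.sum-replicate n) ⟨
    Sum.sum enum + Sum.sum {n} (λ _ → 1#)       ≈⟨ Sum.∑-distrib-+ enum (λ _ → 1#) ⟨
    Sum.sum (λ i → enum i + 1#)                 ≈⟨ Sum.sum-cong-≋ (λ i → enum-index (enum i + 1#)) ⟨
    Sum.sum (λ i → enum (shift i))              ≈⟨ Sum.sum-permute enum (injective⇒permutation shift shift-injective) ⟨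
    Sum.sum enum                                ≈⟨ +-identityʳ _ ⟨
    Sum.sum enum + 0#                           ∎)
    where
    shift : Fin n → Fin n
    shift i = index (enum i + 1#)
    shift-injective : ∀ {i j} → shift i ≡ shift j → i ≡ j
    shift-injective {i} {j} eq = enum-inj i j (+-cancelˡ 1# _ _ (begin
      1# + enum i  ≈⟨ +-comm _ _ ⟩
      enum i + 1#  ≈⟨ index-injective eq ⟩
      enum j + 1#  ≈⟨ +-comm _ _ ⟩
      1# + enum j  ∎))

  √order·1≈0 : ∀ q → n ≡ q ℕ.^ 2 → q · 1# ≈ 0#
  √order·1≈0 q ≡.refl with (q · 1#) ≟ 0#
  ... | yes q≈0 = q≈0
  ... | no  q≉0 = x*y≈0⇒y≈0 q≉0 (begin
    (q · 1#) * (q · 1#)   ≈⟨ ×1-homo-* q q ⟨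
    (q ℕ.* q) · 1#        ≡⟨ ≡.cong (λ k → (q ℕ.* k) · 1#) (ℕₚ.*-identityʳ q) ⟨
    (q ℕ.^ 2) · 1#        ≈⟨ order·1≈0 ⟩
    0#                    ∎)

  √order·x≈0 : ∀ q → n ≡ q ℕ.^ 2 → ∀ x → q · x ≈ 0#
  √order·x≈0 q eq x = begin
    q · x           ≈⟨ ×-congʳ q (*-identityˡ x) ⟨
    q · (1# * x)    ≈⟨ ×-assoc-* q 1# x ⟨
    (q · 1#) * x    ≈⟨ *-congʳ (√order·1≈0 q eq) ⟩
    0# * x          ≈⟨ zeroˡ x ⟩
    0#              ∎

  -- Multiplication by s permutes the m nonzero members of the family, so
  -- their product equals s^m times itself.
  scaling-order : ∀ {m} (a : Fin (suc m) → Carrier) → (∀ i j → a i ≈ a j → i ≡ j) →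
    ∀ {i₀} → a i₀ ≈ 0# → ∀ {s} → ¬ s ≈ 0# → (φ : Fin (suc m) → Fin (suc m)) →
    (∀ i → a (φ i) ≈ s * a i) → s ^ m ≈ 1#
  scaling-order {m} a a-inj {i₀} ai₀≈0 {s} s≉0 φ scale = *-cancelˡ rest≉0 (begin
      Prod.sum rest * s ^ m                        ≈⟨ *-comm _ _ ⟩
      s ^ m * Prod.sum rest                        ≈⟨ *-congʳ (Prod.sum-replicate m) ⟨
      Prod.sum {m} (λ _ → s) * Prod.sum rest       ≈⟨ Prod.∑-distrib-+ (λ _ → s) rest ⟨
      Prod.sum (λ j → s * rest j)                  ≈⟨ Prod.sum-cong-≋ scaled ⟨
      Prod.sum (λ j → nz (a (φ (punch j))))        ≈⟨ *-identityˡ _ ⟨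
      1# * Prod.sum (λ j → nz (a (φ (punch j))))   ≈⟨ *-congʳ (nz-zero aφi₀≈0) ⟨
      nz (a (φ i₀)) * Prod.sum (λ j → nz (a (φ (punch j)))) ≈⟨ Prod.sum-remove {i = i₀} (λ i → nz (a (φ i))) ⟨
      Prod.sum (λ i → nz (a (φ i)))                ≈⟨ Prod.sum-permute (λ i → nz (a i)) (injective⇒permutation φ φ-injective) ⟨
      Prod.sum (λ i → nz (a i))                    ≈⟨ Prod.sum-remove {i = i₀} (λ i → nz (a i)) ⟩
      nz (a i₀) * Prod.sum (λ j → nz (rest j))     ≈⟨ *-cong (nz-zero ai₀≈0) (Prod.sum-cong-≋ (λ j → nz-nonzero (rest≉0ʲ j))) ⟩
      1# * Prod.sum rest                           ≈⟨ *-comm _ _ ⟩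
      Prod.sum rest * 1#                           ∎)
    where
    punch : Fin m → Fin (suc m)
    punch = Fin.punchIn i₀
    rest : Fin m → Carrier
    rest j = a (punch j)
    -- `φ` permutes all indices, so the product is taken over all of them; replacing the zero member
    -- by 1 keeps it equal to the product of the nonzero ones.
    nz : Carrier → Carrier
    nz x with x ≟ 0#
    ... | yes _ = 1#
    ... | no  _ = x
    nz-zero : ∀ {x} → x ≈ 0# → nz x ≈ 1#
    nz-zero {x} x≈0 with x ≟ 0#
    ... | yes _   = refl
    ... | no  x≉0 = contradiction x≈0 x≉0
    nz-nonzero : ∀ {x} → ¬ x ≈ 0# → nz x ≈ x
    nz-nonzero {x} x≉0 with x ≟ 0#
    ... | yes x≈0 = contradiction x≈0 x≉0
    ... | no  _   = refl
    rest≉0ʲ : ∀ j → ¬ rest j ≈ 0#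
    rest≉0ʲ j eq = punchInᵢ≢i i₀ j (a-inj _ _ (trans eq (sym ai₀≈0)))
    aφi₀≈0 : a (φ i₀) ≈ 0#
    aφi₀≈0 = trans (scale i₀) (trans (*-congˡ ai₀≈0) (zeroʳ s))
    scaled : ∀ j → nz (a (φ (punch j))) ≈ s * rest j
    scaled j = trans (nz-nonzero (λ eq → *-≉0 s≉0 (rest≉0ʲ j) (trans (sym (scale (punch j))) eq))) (scale (punch j))
    φ-injective : ∀ {i j} → φ i ≡ φ j → i ≡ j
    φ-injective {i} {j} eq = a-inj i j (*-cancelˡ s≉0
      (trans (sym (scale i)) (trans (reflexive (≡.cong a eq)) (scale j))))
    prod≉0 : ∀ {k} (f : Fin k → Carrier) → (∀ j → ¬ f j ≈ 0#) → ¬ Prod.sum f ≈ 0#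
    prod≉0 {zero}  f f≉0 1≈0 = 0≉1 (sym 1≈0)
    prod≉0 {suc k} f f≉0     = *-≉0 (f≉0 zero) (prod≉0 (f ∘ suc) (f≉0 ∘ suc))
    rest≉0 : ¬ Prod.sum rest ≈ 0#
    rest≉0 = prod≉0 rest rest≉0ʲ

  fermat : ∀ {s} → ¬ s ≈ 0# → s ^ n ≈ s
  fermat {s} s≉0 = go enum enum-inj (enum-index 0#) (λ i → index (s * enum i)) (λ i → enum-index (s * enum i))
    where
    -- `n` is a fixed module parameter and cannot be matched with `suc`; the family therefore has
    -- arbitrary size `k`, and the index `i₀` rules out `k = 0`.
    go : ∀ {k} (a : Fin k → Carrier) → (∀ i j → a i ≈ a j → i ≡ j) → ∀ {i₀} → a i₀ ≈ 0# →
      (φ : Fin k → Fin k) → (∀ i → a (φ i) ≈ s * a i) → s ^ k ≈ s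
    go {suc k} a a-inj ai₀≈0 φ scale = begin
      s * s ^ k  ≈⟨ *-congˡ (scaling-order a a-inj ai₀≈0 s≉0 φ scale) ⟩
      s * 1#     ≈⟨ *-identityʳ s ⟩
      s          ∎

  -- Monic polynomials and roots of unity.

  -- A monic polynomial is given by its lower coefficients, constant term first.
  eval : ∀ {m} → Vec Carrier m → Carrier → Carrier
  eval []       x = 1#
  eval (c ∷ cs) x = c + x * eval cs x

  -- Synthetic division by X - r: the coefficients of the quotient are the partial values of
  -- Horner's rule at `r`. The quotient is again monic, so it fits the same encoding, one degree
  -- lower.
  divide : ∀ {m} (cs : Vec Carrier (suc m)) r →
    ∃ λ (ds : Vec Carrier m) → ∀ x → eval cs x ≈ eval cs r + (x - r) * eval ds x
  divide (c ∷ []) r = [] , λ x → solve 4 (λ c x r e →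
    c :+ x :* e := (c :+ r :* e) :+ (x :- r) :* e) refl c x r 1#
  divide (c ∷ cs@(_ ∷ _)) r with divide cs r
  ... | ds , eq = (eval cs r ∷ ds) , λ x → begin
    c + x * eval cs x                                    ≈⟨ +-congˡ (*-congˡ (eq x)) ⟩
    c + x * (eval cs r + (x - r) * eval ds x)            ≈⟨ solve 5 (λ c x r e d →
      c :+ x :* (e :+ (x :- r) :* d) := (c :+ r :* e) :+ (x :- r) :* (e :+ x :* d)) refl c x r (eval cs r) (eval ds x) ⟩
    (c + r * eval cs r) + (x - r) * (eval cs r + x * eval ds x) ∎

  -- Division by X - ρ 0 leaves no remainder, and the other roots pass to the quotient because they
  -- differ from ρ 0. The empty list encodes the constant 1, which has no root.
  roots≤degree : ∀ {m} (cs : Vec Carrier m) (ρ : Fin (suc m) → Carrier) →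
    (∀ i j → ρ i ≈ ρ j → i ≡ j) → ¬ (∀ i → eval cs (ρ i) ≈ 0#)
  roots≤degree []       ρ ρ-inj root = 0≉1 (sym (root zero))
  roots≤degree (c ∷ cs) ρ ρ-inj root with divide (c ∷ cs) (ρ zero)
  ... | ds , eq = roots≤degree ds (ρ ∘ suc) (λ i j e → suc-injective (ρ-inj _ _ e))
    (λ i → x*y≈0⇒y≈0 (λ d≈0 → 0≢1+n (ρ-inj _ _ (sym (x∙y⁻¹≈ε⇒x≈y _ _ d≈0)))) (begin
      (ρ (suc i) - ρ zero) * eval ds (ρ (suc i))           ≈⟨ +-identityˡ _ ⟨
      0# + (ρ (suc i) - ρ zero) * eval ds (ρ (suc i))      ≈⟨ +-congʳ (root zero) ⟨
      eval (c ∷ cs) (ρ zero) + (ρ (suc i) - ρ zero) * eval ds (ρ (suc i)) ≈⟨ eq (ρ (suc i)) ⟨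
      eval (c ∷ cs) (ρ (suc i))                            ≈⟨ root (suc i) ⟩
      0#                                                   ∎))

  eval-zeros : ∀ m x → eval (replicate m 0#) x ≈ x ^ m
  eval-zeros zero    x = refl
  eval-zeros (suc m) x = trans (+-identityˡ _) (*-congˡ (eval-zeros m x))

  roots-of-unity≤degree : ∀ {m} .{{_ : NonZero m}} (ρ : Fin (suc m) → Carrier) →
    (∀ i j → ρ i ≈ ρ j → i ≡ j) → ¬ (∀ i → ρ i ^ m ≈ 1#)
  -- With the implicit leading 1 these coefficients encode X^(m+1) - 1.
  roots-of-unity≤degree {suc m} ρ ρ-inj unity = roots≤degree (- 1# ∷ replicate m 0#) ρ ρ-inj (λ i → begin
    - 1# + ρ i * eval (replicate m 0#) (ρ i)  ≈⟨ +-congˡ (*-congˡ (eval-zeros m (ρ i))) ⟩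
    - 1# + ρ i * ρ i ^ m                      ≈⟨ +-congˡ (unity i) ⟩
    - 1# + 1#                                 ≈⟨ -‿inverseˡ 1# ⟩
    0#                                        ∎)

  -- Multiplicative orders and generators.

  record Order (g : Carrier) (m : ℕ) : Set where
    field
      -- Phrased by divisibility rather than as a least exponent, so that coprimality arguments
      -- apply directly. An order 0 would mean infinite order, hence the separate `NonZero`
      -- conditions below.
      kills  : ∀ k → m ∣ k → g ^ k ≈ 1#
      forces : ∀ k → g ^ k ≈ 1# → m ∣ k
  open Order

  ^-≈1⇒^-*-≈1 : ∀ {g} k {l} → g ^ l ≈ 1# → g ^ (k ℕ.* l) ≈ 1#
  ^-≈1⇒^-*-≈1 {g} k {l} eq = begin
    g ^ (k ℕ.* l)   ≡⟨ ≡.cong (g ^_) (ℕₚ.*-comm k l) ⟩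
    g ^ (l ℕ.* k)   ≈⟨ ^-assocʳ g l k ⟨
    (g ^ l) ^ k     ≈⟨ ^-congˡ k eq ⟩
    1# ^ k          ≈⟨ 1^k≈1 k ⟩
    1#              ∎

  ^-cancel : ∀ {g} → ¬ g ≈ 0# → ∀ i d → g ^ i ≈ g ^ (i ℕ.+ d) → g ^ d ≈ 1#
  ^-cancel {g} g≉0 i d eq = *-cancelˡ (^-≉0 i g≉0) (begin
    g ^ i * g ^ d   ≈⟨ ^-homo-* g i d ⟨
    g ^ (i ℕ.+ d)   ≈⟨ eq ⟨
    g ^ i           ≈⟨ *-identityʳ _ ⟨
    g ^ i * 1#      ∎)

  -- Descent to the least positive exponent: a smaller one found by the search replaces `m`. When
  -- none is left, the remainder modulo `m` of an exponent giving 1 must be 0, being otherwise a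
  -- smaller such exponent. `fuel` bounds `m` and makes the recursion structural.
  order-from-multiple : ∀ {g} fuel m .{{_ : NonZero m}} → m ℕ.≤ fuel → g ^ m ≈ 1# → ∃ λ k → NonZero k × Order g k
  order-from-multiple {g} zero (suc m) () eq
  order-from-multiple {g} (suc fuel) m m≤fuel eq
    with any? {n = m} (λ i → ¬? (toℕ i ℕₚ.≟ 0) ×-dec (g ^ toℕ i ≟ 1#))
  ... | yes (i , i≢0 , gⁱ≈1) = order-from-multiple fuel (toℕ i) {{ℕ.≢-nonZero i≢0}}
        (ℕₚ.≤-pred (ℕₚ.≤-trans (toℕ<n i) m≤fuel)) gⁱ≈1
  ... | no none = m , ℕ.≢-nonZero (ℕ.≢-nonZero⁻¹ m) , record
    { kills  = λ { k (divides j ≡.refl) → ^-≈1⇒^-*-≈1 j eq }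
    ; forces = λ k gᵏ≈1 → m%n≡0⇒n∣m k m (rem k gᵏ≈1) }
    where
    rem : ∀ k → g ^ k ≈ 1# → k % m ≡ 0
    rem k gᵏ≈1 with k % m ℕₚ.≟ 0
    ... | yes r≡0 = r≡0
    ... | no  r≢0 = contradiction
      ( fromℕ< (m%n<n k m)
      , (λ r≡0 → r≢0 (≡.trans (≡.sym (toℕ-fromℕ< (m%n<n k m))) r≡0))
      , (begin
          g ^ toℕ (fromℕ< (m%n<n k m))                ≡⟨ ≡.cong (g ^_) (toℕ-fromℕ< (m%n<n k m)) ⟩
          g ^ (k % m)                                 ≈⟨ *-identityʳ _ ⟨
          g ^ (k % m) * 1#                            ≈⟨ *-congˡ (^-≈1⇒^-*-≈1 (k / m) eq) ⟨
          g ^ (k % m) * g ^ ((k / m) ℕ.* m)           ≈⟨ ^-homo-* g (k % m) _ ⟨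
          g ^ (k % m ℕ.+ (k / m) ℕ.* m)               ≡⟨ ≡.cong (g ^_) (m≡m%n+[m/n]*n k m) ⟨
          g ^ k                                       ≈⟨ gᵏ≈1 ⟩
          1#                                          ∎) ) none

  private
    <-distinct : ∀ {g m} → ¬ g ≈ 0# → Order g m → ∀ {i j} → i ℕ.< j → j ℕ.< m → ¬ g ^ i ≈ g ^ j
    <-distinct {g} g≉0 ord {i} {j} i<j j<m eq = ℕₚ.<⇒≱ (ℕₚ.≤-<-trans (ℕₚ.m∸n≤m j i) j<m)
      (∣⇒≤ {{ℕ.>-nonZero (ℕₚ.m<n⇒0<n∸m i<j)}} (forces ord (j ℕ.∸ i)
        (^-cancel g≉0 i (j ℕ.∸ i) (trans eq (^-congʳ g (≡.sym (ℕₚ.m+[n∸m]≡n (ℕₚ.<⇒≤ i<j))))))))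

    equal-powers⇒order : ∀ {g} → ¬ g ≈ 0# → ∀ {i j} → i ℕ.< j → g ^ i ≈ g ^ j → ∃ λ k → NonZero k × Order g k
    equal-powers⇒order {g} g≉0 {i} {j} i<j eq =
      order-from-multiple (j ℕ.∸ i) (j ℕ.∸ i) {{ℕ.>-nonZero (ℕₚ.m<n⇒0<n∸m i<j)}} ℕₚ.≤-refl
        (^-cancel g≉0 i (j ℕ.∸ i) (trans eq (^-congʳ g (≡.sym (ℕₚ.m+[n∸m]≡n (ℕₚ.<⇒≤ i<j))))))

  order-exists : ∀ {g} → ¬ g ≈ 0# → ∃ λ m → NonZero m × Order g m
  order-exists {g} g≉0 with pigeonhole (ℕₚ.n<1+n n) (λ i → index (g ^ toℕ i))
  ... | i , j , i<j , eq = equal-powers⇒order g≉0 i<j (index-injective eq)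

  powers-distinct : ∀ {g m} → ¬ g ≈ 0# → Order g m → ∀ i j → i ℕ.< m → j ℕ.< m → g ^ i ≈ g ^ j → i ≡ j
  powers-distinct {g} {m} g≉0 ord i j i<m j<m eq with ℕₚ.<-cmp i j
  ... | tri≈ _ i≡j _ = i≡j
  ... | tri< i<j _ _ = contradiction eq (<-distinct g≉0 ord i<j j<m)
  ... | tri> _ _ j<i = contradiction (sym eq) (<-distinct g≉0 ord j<i i<m)

  order≤field-order : ∀ {g m} → ¬ g ≈ 0# → Order g m → m ℕ.≤ n
  order≤field-order {g} g≉0 ord = injective⇒≤ {f = λ i → index (g ^ toℕ i)} (λ {i} {j} eq →
    toℕ-injective (powers-distinct g≉0 ord (toℕ i) (toℕ j) (toℕ<n i) (toℕ<n j) (index-injective eq)))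

  order-of-power : ∀ {g} a b .{{_ : NonZero a}} → Order g (a ℕ.* b) → Order (g ^ a) b
  order-of-power {g} a b ord = record
    { kills  = λ k b∣k → trans (^-assocʳ g a k) (kills ord (a ℕ.* k) (*-monoʳ-∣ a b∣k))
    ; forces = λ k eq → *-cancelˡ-∣ a (forces ord (a ℕ.* k) (trans (sym (^-assocʳ g a k)) eq)) }

  -- Raising (gh)^k = 1 to the power `b` eliminates `h` and leaves g^(bk) = 1, so `a` divides bk
  -- and, by coprimality, k; symmetrically for `b`.
  order-of-product : ∀ {g h a b} → Order g a → Order h b → Coprime a b → Order (g * h) (a ℕ.* b)
  order-of-product {g} {h} {a} {b} ord-g ord-h coprime = record
    { kills  = λ k ab∣k → begin
        (g * h) ^ k      ≈⟨ ^-distrib-* g h k ⟩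
        g ^ k * h ^ k    ≈⟨ *-cong (kills ord-g k (∣-trans (m∣m*n b) ab∣k)) (kills ord-h k (∣-trans (n∣m*n a) ab∣k)) ⟩
        1# * 1#          ≈⟨ *-identityˡ 1# ⟩
        1#               ∎
    ; forces = λ k eq → coprime-∣* coprime (a∣k k eq) (b∣k k eq) }
    where
    powers : ∀ k l → (g * h) ^ k ≈ 1# → g ^ (l ℕ.* k) * h ^ (l ℕ.* k) ≈ 1#
    powers k l eq = trans (sym (^-distrib-* g h (l ℕ.* k))) (^-≈1⇒^-*-≈1 l eq)
    a∣k : ∀ k → (g * h) ^ k ≈ 1# → a ∣ k
    a∣k k eq = coprime-divisor coprime (forces ord-g (b ℕ.* k) (begin
      g ^ (b ℕ.* k)                      ≈⟨ *-identityʳ _ ⟨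
      g ^ (b ℕ.* k) * 1#                 ≈⟨ *-congˡ (kills ord-h (b ℕ.* k) (m∣m*n k)) ⟨
      g ^ (b ℕ.* k) * h ^ (b ℕ.* k)      ≈⟨ powers k b eq ⟩
      1#                                 ∎))
    b∣k : ∀ k → (g * h) ^ k ≈ 1# → b ∣ k
    b∣k k eq = coprime-divisor (Coprimality.sym coprime) (forces ord-h (a ℕ.* k) (begin
      h ^ (a ℕ.* k)                      ≈⟨ *-identityˡ _ ⟨
      1# * h ^ (a ℕ.* k)                 ≈⟨ *-congʳ (kills ord-g (a ℕ.* k) (m∣m*n k)) ⟨
      g ^ (a ℕ.* k) * h ^ (a ℕ.* k)      ≈⟨ powers k a eq ⟩
      1#                                 ∎))

  -- Otherwise h would be one root of x^m - 1 more than the m powers of g.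
  power-of : ∀ {g h m} .{{_ : NonZero m}} → ¬ g ≈ 0# → Order g m → h ^ m ≈ 1# → ∃ λ k → h ≈ g ^ k
  power-of {g} {h} {m} g≉0 ord hᵐ≈1 with any? {n = m} (λ i → h ≟ g ^ toℕ i)
  ... | yes (i , eq) = toℕ i , eq
  ... | no none = contradiction unity (roots-of-unity≤degree ρ ρ-injective)
    where
    ρ : Fin (suc m) → Carrier
    ρ zero    = h
    ρ (suc i) = g ^ toℕ i
    ρ-injective : ∀ i j → ρ i ≈ ρ j → i ≡ j
    ρ-injective zero    zero    _  = ≡.refl
    ρ-injective zero    (suc j) eq = contradiction (j , eq) none
    ρ-injective (suc i) zero    eq = contradiction (i , sym eq) none
    ρ-injective (suc i) (suc j) eq = ≡.cong suc (toℕ-injective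
      (powers-distinct g≉0 ord _ _ (toℕ<n i) (toℕ<n j) eq))
    unity : ∀ i → ρ i ^ m ≈ 1#
    unity zero    = hᵐ≈1
    unity (suc i) = trans (^-assocʳ g (toℕ i) m) (kills ord (toℕ i ℕ.* m) (n∣m*n (toℕ i)))

  -- With m = p^b m′ and l = l′ p^(b+1), the power g^(p^b) has order m′ and h^l′ has order p^(b+1).
  -- These orders are coprime, so the product has order m′ p^(b+1), which exceeds m.
  larger-order : ∀ {g h l m} .{{_ : NonZero l}} .{{_ : NonZero m}} → Order g m → Order h l → l ∤ m →
    ∃ λ i → ∃ λ j → ∃ λ k → m ℕ.< k × Order (g ^ i * h ^ j) k
  larger-order {g} {h} {l} {m} ord-g ord-h l∤m with ∤⇒prime-power l∤m
  ... | p , b , m′ , l′ , pr , p∤m′ , ≡.refl , ≡.refl =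
    p ℕ.^ b , l′ , m′ ℕ.* p ℕ.^ suc b , bound ,
    order-of-product
      (order-of-power (p ℕ.^ b) m′ {{ℕₚ.m^n≢0 p b {{prime⇒nonZero pr}}}} ord-g)
      (order-of-power l′ (p ℕ.^ suc b) {{ℕₚ.m*n≢0⇒m≢0 l′}} ord-h)
      (Coprimality.sym (coprime-^ (suc b) (prime∤⇒coprime pr p∤m′)))
    where
    bound : p ℕ.^ b ℕ.* m′ ℕ.< m′ ℕ.* p ℕ.^ suc b
    bound = ≡.subst (ℕ._< m′ ℕ.* p ℕ.^ suc b) (ℕₚ.*-comm m′ (p ℕ.^ b))
      (ℕₚ.*-monoʳ-< m′ {{ℕₚ.m*n≢0⇒n≢0 (p ℕ.^ b)}}
        (ℕₚ.^-monoʳ-< p (ℕ.nonTrivial⇒n>1 p {{prime⇒nonTrivial pr}}) (ℕₚ.n<1+n b)))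

  -- A member of maximal order generates.
  cyclic : (S : Carrier → Set) → S 1# → (∀ {x y} → S x → S y → S (x * y)) →
    ∀ {k} (u : Fin k → Carrier) → (∀ i → S (u i)) → (∀ i → ¬ u i ≈ 0#) →
    ∃ λ g → S g × ∀ i → ∃ λ e → u i ≈ g ^ e
  cyclic S S-1 S-* {k} u S-u u≉0 = search n 1# 1 S-1 (λ eq → 0≉1 (sym eq)) order-1 (ℕₚ.m<m+n n (s≤s z≤n))
    where
    order-1 : Order 1# 1
    order-1 = record { kills = λ k _ → 1^k≈1 k ; forces = λ k _ → 1∣ k }
    S-^ : ∀ {x} e → S x → S (x ^ e)
    S-^ zero    S-x = S-1
    S-^ (suc e) S-x = S-* S-x (S-^ e S-x)
    -- Invariant: `n < fuel + m`. Every failed round strictly raises the order `m`, and no order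
    -- exceeds `n`, so the fuel cannot run out.
    search : ∀ fuel g m .{{_ : NonZero m}} → S g → ¬ g ≈ 0# → Order g m → n ℕ.< fuel ℕ.+ m →
      ∃ λ g → S g × ∀ i → ∃ λ e → u i ≈ g ^ e
    search zero g m S-g g≉0 ord n<m = contradiction (order≤field-order g≉0 ord) (ℕₚ.<⇒≱ n<m)
    search (suc fuel) g m S-g g≉0 ord n<fuel+m with all? (λ i → u i ^ m ≟ 1#)
    ... | yes all = g , S-g , λ i → power-of g≉0 ord (all i)
    ... | no ¬all with ¬∀⟶∃¬ k _ (λ i → u i ^ m ≟ 1#) ¬all
    ... | i , uᵢᵐ≉1 with order-exists (u≉0 i)
    ... | l , l≢0 , ord-u with larger-order {{l≢0}} ord ord-u (λ l∣m → uᵢᵐ≉1 (kills ord-u m l∣m))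
    ... | a , b , m′ , m<m′ , ord′ = search fuel (g ^ a * u i ^ b) m′ {{ℕ.>-nonZero (ℕₚ.≤-<-trans z≤n m<m′)}}
        (S-* (S-^ a S-g) (S-^ b (S-u i))) (*-≉0 (^-≉0 a g≉0) (^-≉0 b (u≉0 i))) ord′
        (ℕₚ.<-≤-trans n<fuel+m (ℕₚ.≤-trans (ℕₚ.≤-reflexive (≡.sym (ℕₚ.+-suc fuel m))) (ℕₚ.+-monoʳ-≤ fuel m<m′)))

-- Projective coordinates adapted to two lines

module CoordinateChange {n : ℕ} (F : CommutativeRing 0ℓ 0ℓ) (finite : IsFiniteFieldOfOrder n F) where
  open CommutativeRing F hiding (zero)
  open IntegerSolver F
  open FiniteField F finite
  open ProjectivePlane F
  open Relation.Binary.Reasoning.Setoid setoid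

  infix 8 _∙_
  _∙_ : Vec3 → Vec3 → Carrier
  (x , y , z) ∙ (a , b , c) = (x * a + y * b) + z * c

  infix 9 _⨯_
  _⨯_ : Vec3 → Vec3 → Vec3
  (x , y , z) ⨯ (a , b , c) = y * c - z * b , z * a - x * c , x * b - y * a

  det : Vec3 → Vec3 → Vec3 → Carrier
  det u v w = w ∙ (u ⨯ v)

  infix 4 _≋_
  _≋_ : Vec3 → Vec3 → Set
  (x , y , z) ≋ (a , b , c) = x ≈ a × y ≈ b × z ≈ c

  infixr 8 _⊙_
  _⊙_ : Carrier → Vec3 → Vec3
  c ⊙ (x , y , z) = c * x , c * y , c * z

  infixl 7 _⊞_
  _⊞_ : Vec3 → Vec3 → Vec3
  (x , y , z) ⊞ (a , b , c) = x + a , y + b , z + c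

  private
    +-rotate : ∀ x y z → (x + y) + z ≈ (y + z) + x
    +-rotate x y z = trans (+-assoc x y z) (+-comm x (y + z))

    combination-cong : ∀ {a b c a′ b′ c′} {p q r} → a ≈ a′ → b ≈ b′ → c ≈ c′ →
      (a * p + b * q) + c * r ≈ (a′ * p + b′ * q) + c′ * r
    combination-cong ea eb ec = +-cong (+-cong (*-congʳ ea) (*-congʳ eb)) (*-congʳ ec)

  -- The solver proves the first coordinate only. A cyclic rotation of the coordinates merely
  -- rotates the summands of each determinant, which `+-rotate` undoes, and this yields the other
  -- two. The three determinants on the right become the coefficients of a block's line in the new
  -- coordinates.
  cramer : ∀ u v w l → det u v w ⊙ l ≋ det l v w ⊙ u ⊞ det u l w ⊙ v ⊞ det u v l ⊙ w
  cramer (a , b , c) (d , e , f) (g , h , i) (x , y , z) =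
    identity a b c d e f g h i x y z ,
    trans (*-congʳ (+-rotate _ _ _)) (trans (identity b c a e f d h i g y z x)
      (sym (combination-cong (+-rotate _ _ _) (+-rotate _ _ _) (+-rotate _ _ _)))) ,
    trans (*-congʳ (sym (+-rotate _ _ _))) (trans (identity c a b f d e i g h z x y)
      (combination-cong (+-rotate _ _ _) (+-rotate _ _ _) (+-rotate _ _ _)))
    where
    identity : ∀ a b c d e f g h i x y z → det (a , b , c) (d , e , f) (g , h , i) * x ≈
      (det (x , y , z) (d , e , f) (g , h , i) * a + det (a , b , c) (x , y , z) (g , h , i) * d)
        + det (a , b , c) (d , e , f) (x , y , z) * g
    identity = solve 12 (λ a b c d e f g h i x y z →
      let det = λ (a , b , c) (d , e , f) (x , y , z) →
            (x :* (b :* f :- c :* e) :+ y :* (c :* d :- a :* f)) :+ z :* (a :* e :- b :* d) in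
      det (a , b , c) (d , e , f) (g , h , i) :* x :=
        (det (x , y , z) (d , e , f) (g , h , i) :* a :+ det (a , b , c) (x , y , z) (g , h , i) :* d)
          :+ det (a , b , c) (d , e , f) (x , y , z) :* g) refl

  -- The cross products are the vertices of the triangle with sides `u`, `v`, `w`. A point is thus
  -- recovered from `p ∙ u`, `p ∙ v`, `p ∙ w`, which makes these values projective coordinates.
  cramer-dual : ∀ u v w p → det u v w ⊙ p ≋ (p ∙ u) ⊙ (v ⨯ w) ⊞ (p ∙ v) ⊙ (w ⨯ u) ⊞ (p ∙ w) ⊙ (u ⨯ v)
  cramer-dual (a , b , c) (d , e , f) (g , h , i) (x , y , z) =
    identity a b c d e f g h i x y z ,
    trans (*-congʳ (+-rotate _ _ _)) (trans (identity b c a e f d h i g y z x)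
      (sym (combination-cong (+-rotate _ _ _) (+-rotate _ _ _) (+-rotate _ _ _)))) ,
    trans (*-congʳ (sym (+-rotate _ _ _))) (trans (identity c a b f d e i g h z x y)
      (combination-cong (+-rotate _ _ _) (+-rotate _ _ _) (+-rotate _ _ _)))
    where
    identity : ∀ a b c d e f g h i x y z → det (a , b , c) (d , e , f) (g , h , i) * x ≈
      (((x * a + y * b) + z * c) * (e * i - f * h) + ((x * d + y * e) + z * f) * (h * c - i * b))
        + ((x * g + y * h) + z * i) * (b * f - c * e)
    identity = solve 12 (λ a b c d e f g h i x y z →
      ((g :* (b :* f :- c :* e) :+ h :* (c :* d :- a :* f)) :+ i :* (a :* e :- b :* d)) :* x :=
      (((x :* a :+ y :* b) :+ z :* c) :* (e :* i :- f :* h) :+ ((x :* d :+ y :* e) :+ z :* f) :* (h :* c :- i :* b))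
        :+ ((x :* g :+ y :* h) :+ z :* i) :* (b :* f :- c :* e)) refl

  ∙-cong : ∀ p {u v} → u ≋ v → p ∙ u ≈ p ∙ v
  ∙-cong p (e₁ , e₂ , e₃) = +-cong (+-cong (*-congˡ e₁) (*-congˡ e₂)) (*-congˡ e₃)

  ∙-⊙ : ∀ c p u → p ∙ (c ⊙ u) ≈ c * (p ∙ u)
  ∙-⊙ c (x , y , z) (a , b , d) = solve 7 (λ c x y z a b d →
    (x :* (c :* a) :+ y :* (c :* b)) :+ z :* (c :* d) := c :* ((x :* a :+ y :* b) :+ z :* d)) refl c x y z a b d

  ∙-⊞ : ∀ p u v → p ∙ (u ⊞ v) ≈ p ∙ u + p ∙ v
  ∙-⊞ (x , y , z) (a , b , c) (d , e , f) = solve 9 (λ x y z a b c d e f →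
    (x :* (a :+ d) :+ y :* (b :+ e)) :+ z :* (c :+ f) :=
    ((x :* a :+ y :* b) :+ z :* c) :+ ((x :* d :+ y :* e) :+ z :* f)) refl x y z a b c d e f

  cramer-∙ : ∀ u v w l p →
    det u v w * (p ∙ l) ≈ (p ∙ u * det l v w + p ∙ v * det u l w) + p ∙ w * det u v l
  cramer-∙ u v w l p = begin
    det u v w * (p ∙ l)                ≈⟨ ∙-⊙ (det u v w) p l ⟨
    p ∙ (det u v w ⊙ l)                ≈⟨ ∙-cong p (cramer u v w l) ⟩
    p ∙ (det l v w ⊙ u ⊞ det u l w ⊙ v ⊞ det u v l ⊙ w)
                                       ≈⟨ ∙-⊞ p (det l v w ⊙ u ⊞ det u l w ⊙ v) (det u v l ⊙ w) ⟩
    p ∙ (det l v w ⊙ u ⊞ det u l w ⊙ v) + p ∙ (det u v l ⊙ w)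
                                       ≈⟨ +-cong (trans (∙-⊞ p (det l v w ⊙ u) (det u l w ⊙ v)) (+-cong (pull _ u) (pull _ v))) (pull _ w) ⟩
    (p ∙ u * det l v w + p ∙ v * det u l w) + p ∙ w * det u v l ∎
    where
    pull : ∀ c t → p ∙ (c ⊙ t) ≈ p ∙ t * c
    pull c t = trans (∙-⊙ c p t) (*-comm c (p ∙ t))

  combination≈0 : ∀ {D l a b c} A B C → ¬ D ≈ 0# → D * l ≈ (a * A + b * B) + c * C →
    a ≈ 0# → b ≈ 0# → c ≈ 0# → l ≈ 0#
  combination≈0 {D} {l} {a} {b} {c} A B C D≉0 eq a≈0 b≈0 c≈0 = x*y≈0⇒y≈0 D≉0 (begin
    D * l                          ≈⟨ eq ⟩
    (a * A + b * B) + c * C        ≈⟨ combination-cong a≈0 b≈0 c≈0 ⟩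
    (0# * A + 0# * B) + 0# * C     ≈⟨ +-cong (+-cong (zeroˡ A) (zeroˡ B)) (zeroˡ C) ⟩
    (0# + 0#) + 0#                 ≈⟨ trans (+-identityʳ _) (+-identityʳ _) ⟩
    0#                             ∎)

  -- With a nonzero coordinate `a` of `u` as pivot and `d` the matching coordinate of `v`, the
  -- difference a (p ∙ v) - d (p ∙ u) is a combination of coordinates of `u ⨯ v`. This serves to
  -- show that disjoint blocks lie on different lines.
  dependent⇒same-zeros : ∀ {u v} → NonZero3 u → u ⨯ v ≋ (0# , 0# , 0#) → ∀ p → p ∙ u ≈ 0# → p ∙ v ≈ 0#
  dependent⇒same-zeros {a , b , c} {d , e , f} u≉0 (X≈0 , Y≈0 , Z≈0) (x , y , z) pu≈0
    with a ≟ 0# | b ≟ 0# | c ≟ 0#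
  ... | no a≉0  | _ | _ = combination≈0 d y (- z) a≉0 (expand₁ a b c d e f x y z) pu≈0 Z≈0 Y≈0
    where
    expand₁ : ∀ a b c d e f x y z → a * ((x * d + y * e) + z * f) ≈
      (((x * a + y * b) + z * c) * d + (a * e - b * d) * y) + (c * d - a * f) * (- z)
    expand₁ = solve 9 (λ a b c d e f x y z → a :* ((x :* d :+ y :* e) :+ z :* f) :=
      (((x :* a :+ y :* b) :+ z :* c) :* d :+ (a :* e :- b :* d) :* y) :+ (c :* d :- a :* f) :* (:- z)) refl
  ... | yes _ | no b≉0 | _ = combination≈0 e z (- x) b≉0 (expand₂ a b c d e f x y z) pu≈0 X≈0 Z≈0
    where
    expand₂ : ∀ a b c d e f x y z → b * ((x * d + y * e) + z * f) ≈
      (((x * a + y * b) + z * c) * e + (b * f - c * e) * z) + (a * e - b * d) * (- x)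
    expand₂ = solve 9 (λ a b c d e f x y z → b :* ((x :* d :+ y :* e) :+ z :* f) :=
      (((x :* a :+ y :* b) :+ z :* c) :* e :+ (b :* f :- c :* e) :* z) :+ (a :* e :- b :* d) :* (:- x)) refl
  ... | yes _ | yes _ | no c≉0 = combination≈0 f x (- y) c≉0 (expand₃ a b c d e f x y z) pu≈0 Y≈0 X≈0
    where
    expand₃ : ∀ a b c d e f x y z → c * ((x * d + y * e) + z * f) ≈
      (((x * a + y * b) + z * c) * f + (c * d - a * f) * x) + (b * f - c * e) * (- y)
    expand₃ = solve 9 (λ a b c d e f x y z → c :* ((x :* d :+ y :* e) :+ z :* f) :=
      (((x :* a :+ y :* b) :+ z :* c) :* f :+ (c :* d :- a :* f) :* x) :+ (b :* f :- c :* e) :* (:- y)) refl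
  ... | yes a≈0 | yes b≈0 | yes c≈0 = contradiction (a≈0 , b≈0 , c≈0) u≉0

  extend-to-basis : ∀ u v → ¬ (u ⨯ v ≋ (0# , 0# , 0#)) → ∃ λ w → ¬ det u v w ≈ 0#
  extend-to-basis u v N≉0 = choose (u ⨯ v) N≉0
    where
    choose : ∀ N → ¬ (N ≋ (0# , 0# , 0#)) → ∃ λ w → ¬ w ∙ N ≈ 0#
    choose (X , Y , Z) N≉0 with X ≟ 0# | Y ≟ 0# | Z ≟ 0#
    ... | no X≉0  | _       | _       = (1# , 0# , 0#) , λ eq → X≉0 (trans
          (sym (trans (+-cong (+-cong (*-identityˡ X) (zeroˡ Y)) (zeroˡ Z)) (trans (+-identityʳ _) (+-identityʳ X)))) eq)
    ... | yes _   | no Y≉0  | _       = (0# , 1# , 0#) , λ eq → Y≉0 (trans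
          (sym (trans (+-cong (+-cong (zeroˡ X) (*-identityˡ Y)) (zeroˡ Z)) (trans (+-identityʳ _) (+-identityˡ Y)))) eq)
    ... | yes _   | yes _   | no Z≉0  = (0# , 0# , 1#) , λ eq → Z≉0 (trans
          (sym (trans (+-cong (+-cong (zeroˡ X) (zeroˡ Y)) (*-identityˡ Z)) (trans (+-congʳ (+-identityʳ 0#)) (+-identityˡ Z)))) eq)
    ... | yes X≈0 | yes Y≈0 | yes Z≈0 = contradiction (X≈0 , Y≈0 , Z≈0) N≉0

  combination-scales : ∀ D {p p′} A B C {a b e a′ b′ e′} c → ¬ D ≈ 0# →
    D ⊙ p ≋ a ⊙ A ⊞ b ⊙ B ⊞ e ⊙ C → D ⊙ p′ ≋ a′ ⊙ A ⊞ b′ ⊙ B ⊞ e′ ⊙ C →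
    a′ ≈ c * a → b′ ≈ c * b → e′ ≈ c * e → p′ ≋ c ⊙ p
  combination-scales D (A₁ , A₂ , A₃) (B₁ , B₂ , B₃) (C₁ , C₂ , C₃) {a} {b} {e} {a′} {b′} {e′} c D≉0
    (r₁ , r₂ , r₃) (s₁ , s₂ , s₃) ea eb ee = scaled A₁ B₁ C₁ r₁ s₁ , scaled A₂ B₂ C₂ r₂ s₂ , scaled A₃ B₃ C₃ r₃ s₃
    where
    scaled : ∀ {r s} A B C → D * r ≈ (a * A + b * B) + e * C → D * s ≈ (a′ * A + b′ * B) + e′ * C → s ≈ c * r
    scaled {r} {s} A B C Dr Ds = *-cancelˡ D≉0 (begin
      D * s                                          ≈⟨ Ds ⟩
      (a′ * A + b′ * B) + e′ * C                     ≈⟨ combination-cong ea eb ee ⟩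
      (c * a * A + c * b * B) + c * e * C            ≈⟨ solve 7 (λ a b e A B C c →
        (c :* a :* A :+ c :* b :* B) :+ c :* e :* C := c :* ((a :* A :+ b :* B) :+ e :* C)) refl a b e A B C c ⟩
      c * ((a * A + b * B) + e * C)                  ≈⟨ *-congˡ Dr ⟨
      c * (D * r)                                    ≈⟨ solve 3 (λ c D r → c :* (D :* r) := D :* (c :* r)) refl c D r ⟩
      D * (c * r)                                    ∎)

  combination-vanishes : ∀ D {l} u v w {A B C} → ¬ D ≈ 0# → D ⊙ l ≋ A ⊙ u ⊞ B ⊙ v ⊞ C ⊙ w →
    A ≈ 0# × B ≈ 0# × C ≈ 0# → l ≋ (0# , 0# , 0#)
  combination-vanishes D (u₁ , u₂ , u₃) (v₁ , v₂ , v₃) (w₁ , w₂ , w₃) D≉0 (e₁ , e₂ , e₃) (A≈0 , B≈0 , C≈0) =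
    combination≈0 u₁ v₁ w₁ D≉0 e₁ A≈0 B≈0 C≈0 , combination≈0 u₂ v₂ w₂ D≉0 e₂ A≈0 B≈0 C≈0 ,
    combination≈0 u₃ v₃ w₃ D≉0 e₃ A≈0 B≈0 C≈0

  module _ {q : ℕ} (U : AbstractUnital q) where
    open AbstractUnital U

    -- The interface between the embedding and the perspectivities, which never see the original
    -- coordinates. `separates` makes the triple (α, β, γ) injective up to scalars, and `line` says
    -- that blocks are still cut out by lines.
    record Frame (b₁ b₂ : Block) : Set where
      field
        α β γ     : Point → Carrier
        on-b₁     : ∀ P → P ∈ b₁ → α P ≈ 0#
        in-b₁     : ∀ P → α P ≈ 0# → P ∈ b₁
        on-b₂     : ∀ P → P ∈ b₂ → β P ≈ 0#
        in-b₂     : ∀ P → β P ≈ 0# → P ∈ b₂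
        separates : ∀ P Q c → ¬ c ≈ 0# → α Q ≈ c * α P → β Q ≈ c * β P → γ Q ≈ c * γ P → P ≡ Q
        line      : ∀ b → ∃ λ k → ∃ λ l → ∃ λ m → NonZero3 (k , l , m) × (∀ P →
                      (P ∈ b → (α P * k + β P * l) + γ P * m ≈ 0#) ×
                      ((α P * k + β P * l) + γ P * m ≈ 0# → P ∈ b))

    frame-from-basis : (E : EmbeddedIn U F) → let open EmbeddedIn E in ∀ {b₁ b₂} u v w → ¬ det u v w ≈ 0# →
      (∀ P → (P ∈ b₁ → Incident (coord P) u) × (Incident (coord P) u → P ∈ b₁)) →
      (∀ P → (P ∈ b₂ → Incident (coord P) v) × (Incident (coord P) v → P ∈ b₂)) → Frame b₁ b₂
    frame-from-basis E u v w D≉0 on-u on-v = record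
      { α = λ P → coord P ∙ u
      ; β = λ P → coord P ∙ v
      ; γ = λ P → coord P ∙ w
      ; on-b₁ = λ P → proj₁ (on-u P)
      ; in-b₁ = λ P → proj₂ (on-u P)
      ; on-b₂ = λ P → proj₁ (on-v P)
      ; in-b₂ = λ P → proj₂ (on-v P)
      ; separates = λ P Q c c≉0 eα eβ eγ → coord-inj P Q (c , c≉0 ,
          combination-scales (det u v w) (v ⨯ w) (w ⨯ u) (u ⨯ v) c D≉0
            (cramer-dual u v w (coord P)) (cramer-dual u v w (coord Q)) eα eβ eγ)
      ; line = λ b → line (blockLine b) }
      where
      open EmbeddedIn E
      line : ∀ {b} → (∃ λ l → NonZero3 l × ∀ P → (P ∈ b → Incident (coord P) l) × (Incident (coord P) l → P ∈ b)) →
        ∃ λ A → ∃ λ B → ∃ λ C → NonZero3 (A , B , C) × (∀ P →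
          (P ∈ b → (coord P ∙ u * A + coord P ∙ v * B) + coord P ∙ w * C ≈ 0#) ×
          ((coord P ∙ u * A + coord P ∙ v * B) + coord P ∙ w * C ≈ 0# → P ∈ b))
      line (l , l≉0 , on-l) = det l v w , det u l w , det u v l ,
        (λ ABC≈0 → l≉0 (combination-vanishes (det u v w) u v w D≉0 (cramer u v w l) ABC≈0)) ,
        (λ P → (λ P∈b → trans (sym (cramer-∙ u v w l (coord P))) (trans (*-congˡ (proj₁ (on-l P) P∈b)) (zeroʳ _))) ,
               (λ eq → proj₂ (on-l P) (x*y≈0⇒y≈0 D≉0 (trans (cramer-∙ u v w l (coord P)) eq))))

    frame : EmbeddedIn U F → ∀ {b₁ b₂} → ∃ (_∈ b₁) → UnitalTheory.Disjoint U b₁ b₂ → Frame b₁ b₂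
    frame E {b₁} {b₂} (P₀ , P₀∈b₁) disjoint = frame-from-basis E u v (proj₁ basis) (proj₂ basis) on-u on-v
      where
      open EmbeddedIn E
      u v : Vec3
      u = proj₁ (blockLine b₁)
      v = proj₁ (blockLine b₂)
      on-u = proj₂ (proj₂ (blockLine b₁))
      on-v = proj₂ (proj₂ (blockLine b₂))
      basis : ∃ λ w → ¬ det u v w ≈ 0#
      -- Were `u ⨯ v` zero, the point `P₀` of `b₁` would also lie on the line of `b₂`, hence in both
      -- blocks.
      basis = extend-to-basis u v (λ N≈0 → disjoint P₀ P₀∈b₁ (proj₂ (on-v P₀)
        (dependent⇒same-zeros (proj₁ (proj₂ (blockLine b₁))) N≈0 (coord P₀) (proj₁ (on-u P₀) P₀∈b₁))))

-- Counting in unitals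

covered⇒≤ : ∀ {m k} {B : Set} (f : Fin m → B) (g : Fin k → B) → (∀ {i j} → f i ≡ f j → i ≡ j) →
  (∀ i → ∃ λ j → g j ≡ f i) → m ℕ.≤ k
covered⇒≤ f g f-inj cover = injective⇒≤ {f = proj₁ ∘ cover} (λ {i} {j} eq →
  f-inj (≡.trans (≡.sym (proj₂ (cover i))) (≡.trans (≡.cong g eq) (proj₂ (cover j)))))

remQuot-injective : ∀ {m} k {i j : Fin (m ℕ.* k)} → remQuot {m} k i ≡ remQuot {m} k j → i ≡ j
remQuot-injective {m} k {i} {j} eq =
  ≡.trans (≡.sym (combine-remQuot {m} k i)) (≡.trans (≡.cong (uncurry combine) eq) (combine-remQuot {m} k j))

-- `Block` has no enumeration, so the existence of a block cannot be decided by running through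
-- blocks. A search over points either meets a witness of `B` or yields the premise of a counting
-- argument.
all-or : ∀ {n} {A : Fin n → Set} {B : Set} → (∀ i → A i ⊎ B) → (∀ i → A i) ⊎ B
all-or {zero}  f = inj₁ λ ()
all-or {suc n} {A} f with f zero | all-or {n} {A ∘ suc} (f ∘ suc)
... | inj₂ b | _      = inj₂ b
... | inj₁ a | inj₂ b = inj₂ b
... | inj₁ a | inj₁ r = inj₁ λ { zero → a ; (suc i) → r i }

-- The q + 1 blocks joining a point to the points of one block cover at most (q + 1) q of the q³
-- other points.
[1+q]*q<q³ : ∀ {q} → 2 ℕ.≤ q → suc q ℕ.* q ℕ.< q ℕ.^ 3
[1+q]*q<q³ {q} 2≤q = begin-strict
  suc q ℕ.* q              <⟨ ℕₚ.*-monoˡ-< q {{ℕ.>-nonZero (ℕₚ.<-trans (s≤s z≤n) 2≤q)}} (ℕₚ.+-monoˡ-≤ q 2≤q) ⟩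
  (q ℕ.+ q) ℕ.* q          ≡⟨ ≡.cong (λ k → (q ℕ.+ k) ℕ.* q) (ℕₚ.+-identityʳ q) ⟨
  2 ℕ.* q ℕ.* q            ≤⟨ ℕₚ.*-monoˡ-≤ q (ℕₚ.*-monoˡ-≤ q 2≤q) ⟩
  q ℕ.* q ℕ.* q            ≡⟨ cube q ⟨
  q ℕ.^ 3                  ∎
  where
  open ℕₚ.≤-Reasoning
  cube : ∀ q → q ℕ.^ 3 ≡ q ℕ.* q ℕ.* q
  cube q = ≡.trans (≡.cong (λ k → q ℕ.* (q ℕ.* k)) (ℕₚ.*-identityʳ q)) (≡.sym (ℕₚ.*-assoc q q q))

-- The same count for the points of two blocks. At q = 2 it would read 12 < 8, hence the separate
-- treatment of that order.
[2+2q]*q<q³ : ∀ {q} → 3 ℕ.≤ q → (suc q ℕ.+ suc q) ℕ.* q ℕ.< q ℕ.^ 3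
[2+2q]*q<q³ {q} 3≤q = begin-strict
  (suc q ℕ.+ suc q) ℕ.* q  ≡⟨ ≡.cong (ℕ._* q) (ℕₚ.+-suc (suc q) q) ⟩
  (2 ℕ.+ (q ℕ.+ q)) ℕ.* q  <⟨ ℕₚ.*-monoˡ-< q {{ℕ.>-nonZero (ℕₚ.<-trans (s≤s z≤n) 3≤q)}} (ℕₚ.+-monoˡ-≤ (q ℕ.+ q) 3≤q) ⟩
  (q ℕ.+ (q ℕ.+ q)) ℕ.* q  ≡⟨ ≡.cong (λ k → (q ℕ.+ (q ℕ.+ k)) ℕ.* q) (ℕₚ.+-identityʳ q) ⟨
  3 ℕ.* q ℕ.* q            ≤⟨ ℕₚ.*-monoˡ-≤ q (ℕₚ.*-monoˡ-≤ q 3≤q) ⟩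
  q ℕ.* q ℕ.* q            ≡⟨ ≡.trans (≡.cong (λ k → q ℕ.* (q ℕ.* k)) (ℕₚ.*-identityʳ q)) (≡.sym (ℕₚ.*-assoc q q q)) ⟨
  q ℕ.^ 3                  ∎
  where open ℕₚ.≤-Reasoning

2+2q<1+q³ : ∀ {q} → 2 ℕ.≤ q → suc q ℕ.+ suc q ℕ.< suc (q ℕ.^ 3)
2+2q<1+q³ {q} 2≤q = s≤s (begin
  suc q ℕ.+ suc q          ≡⟨ ≡.cong (suc q ℕ.+_) (ℕₚ.+-identityʳ (suc q)) ⟨
  2 ℕ.* suc q              ≤⟨ ℕₚ.*-monoˡ-≤ (suc q) 2≤q ⟩
  q ℕ.* suc q              ≡⟨ ℕₚ.*-comm q (suc q) ⟩
  suc q ℕ.* q              ≤⟨ ℕₚ.<⇒≤ ([1+q]*q<q³ 2≤q) ⟩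
  q ℕ.^ 3                  ∎)
  where open ℕₚ.≤-Reasoning

module Counting {q : ℕ} (U : AbstractUnital q) where
  open AbstractUnital U
  open UnitalTheory U

  private
    pointEnum : Fin (suc (q ℕ.^ 3)) ↔ Point
    pointEnum = ≡.subst (λ k → Fin k ↔ Point) (ℕₚ.+-comm (q ℕ.^ 3) 1) points
    memberEnum : ∀ b → Fin (suc q) ↔ Σ Point (_∈ b)
    memberEnum b = ≡.subst (λ k → Fin k ↔ Σ Point (_∈ b)) (ℕₚ.+-comm q 1) (blockSize b)

  point : Fin (suc (q ℕ.^ 3)) → Point
  point = Inverse.to pointEnum

  number : Point → Fin (suc (q ℕ.^ 3))
  number = Inverse.from pointEnum

  point-number : ∀ P → point (number P) ≡ P
  point-number P = Inverse.strictlyInverseˡ pointEnum P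

  point-injective : ∀ {i j} → point i ≡ point j → i ≡ j
  point-injective {i} {j} eq = ≡.trans (≡.sym (Inverse.strictlyInverseʳ pointEnum i))
    (≡.trans (≡.cong number eq) (Inverse.strictlyInverseʳ pointEnum j))

  number-injective : ∀ {P Q} → number P ≡ number Q → P ≡ Q
  number-injective {P} {Q} eq = ≡.trans (≡.sym (point-number P)) (≡.trans (≡.cong point eq) (point-number Q))

  infix 4 _≟ₚ_ _∈?_
  _≟ₚ_ : (P Q : Point) → Dec (P ≡ Q)
  P ≟ₚ Q = map′ number-injective (≡.cong number) (number P ≟ᶠ number Q)

  _∈?_ : ∀ P b → Dec (P ∈ b)
  P ∈? b = inc P b Bool.≟ true

  anyPoint? : {A : Point → Set} → (∀ P → Dec (A P)) → Dec (∃ A)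
  anyPoint? {A} A? = map′ (λ (i , a) → point i , a) (λ (P , a) → number P , ≡.subst A (≡.sym (point-number P)) a)
    (any? (A? ∘ point))

  member : ∀ b → Fin (suc q) → Point
  member b i = proj₁ (Inverse.to (memberEnum b) i)

  member-∈ : ∀ b i → member b i ∈ b
  member-∈ b i = proj₂ (Inverse.to (memberEnum b) i)

  position : ∀ b {P} → P ∈ b → Fin (suc q)
  position b P∈b = Inverse.from (memberEnum b) (_ , P∈b)

  member-position : ∀ b {P} (P∈b : P ∈ b) → member b (position b P∈b) ≡ P
  member-position b P∈b = ≡.cong proj₁ (Inverse.strictlyInverseˡ (memberEnum b) (_ , P∈b))

  member-injective : ∀ b {i j} → member b i ≡ member b j → i ≡ j
  member-injective b {i} {j} eq = ≡.trans (≡.sym (Inverse.strictlyInverseʳ (memberEnum b) i))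
    (≡.trans (≡.cong (Inverse.from (memberEnum b)) (Σ-≡,≡→≡ (eq , Decidable⇒UIP.≡-irrelevant Bool._≟_ _ _)))
      (Inverse.strictlyInverseʳ (memberEnum b) j))

  -- Blocks through a given point.

  block-unique : ∀ {P Q b c} → P ≢ Q → P ∈ b → Q ∈ b → P ∈ c → Q ∈ c → b ≡ c
  block-unique P≢Q P∈b Q∈b P∈c Q∈c with join _ _ P≢Q
  ... | d , _ , _ , unique = ≡.trans (unique _ P∈b Q∈b) (≡.sym (unique _ P∈c Q∈c))

  ∈∉⇒≢ : ∀ {P Q b} → P ∈ b → ¬ Q ∈ b → P ≢ Q
  ∈∉⇒≢ P∈b Q∉b ≡.refl = Q∉b P∈b

  -- The q³ points other than `P` are covered by the `k` blocks joining `P` to the targets, each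
  -- with q points besides `P`.
  transversals≤ : ∀ {k} P (target : Fin k → Point) → (∀ i → P ≢ target i) →
    (∀ Z → P ≢ Z → ∃ λ i → ∃ λ c → P ∈ c × Z ∈ c × target i ∈ c) → q ℕ.^ 3 ℕ.≤ k ℕ.* q
  transversals≤ {k} P target P≢target hits =
    covered⇒≤ other (uncurry on-line ∘ remQuot {k} q) (λ eq → punchIn-injective (number P) _ _ (point-injective eq))
      (λ j → cover (other j) (other≢ j))
    where
    other : Fin (q ℕ.^ 3) → Point
    other j = point (punchIn (number P) j)
    other≢ : ∀ j → P ≢ other j
    other≢ j eq = punchInᵢ≢i (number P) j (≡.sym (point-injective (≡.trans (point-number P) eq)))
    joining : Fin k → Block
    joining i = proj₁ (join P (target i) (P≢target i))
    P∈joining : ∀ i → P ∈ joining i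
    P∈joining i = proj₁ (proj₂ (join P (target i) (P≢target i)))
    on-line : Fin k → Fin q → Point
    on-line i j = member (joining i) (punchIn (position (joining i) (P∈joining i)) j)
    cover : ∀ Z → P ≢ Z → ∃ λ j → uncurry on-line (remQuot {k} q j) ≡ Z
    cover Z P≢Z with hits Z P≢Z
    ... | i , c , P∈c , Z∈c , t∈c = combine i (punchOut pos≢) , (begin
      uncurry on-line (remQuot {k} q (combine i (punchOut pos≢)))  ≡⟨ ≡.cong (uncurry on-line) (remQuot-combine i (punchOut pos≢)) ⟩
      on-line i (punchOut pos≢)                                    ≡⟨ ≡.cong (member (joining i)) (punchIn-punchOut pos≢) ⟩
      member (joining i) (position (joining i) Z∈)                 ≡⟨ member-position (joining i) Z∈ ⟩
      Z                                                            ∎)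
      where
      open ≡.≡-Reasoning
      Z∈ : Z ∈ joining i
      Z∈ = ≡.subst (Z ∈_) (proj₂ (proj₂ (proj₂ (join P (target i) (P≢target i)))) c P∈c t∈c) Z∈c
      pos≢ : position (joining i) (P∈joining i) ≢ position (joining i) Z∈
      pos≢ eq = P≢Z (≡.trans (≡.sym (member-position (joining i) (P∈joining i)))
        (≡.trans (≡.cong (member (joining i)) eq) (member-position (joining i) Z∈)))

  -- Joining `P` to every other point reaches all the blocks that matter. If each of them hit a
  -- target, `transversals≤` would contradict the bound on `k`.
  avoiding-block : ∀ {k} P (target : Fin k → Point) → (∀ i → P ≢ target i) → k ℕ.* q ℕ.< q ℕ.^ 3 →
    ∃ λ c → P ∈ c × ∀ i → ¬ target i ∈ c
  avoiding-block {k} P target P≢target few with all-or search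
    where
    search : ∀ j → (P ≢ point j → ∃ λ i → ∃ λ c → P ∈ c × point j ∈ c × target i ∈ c) ⊎ (∃ λ c → P ∈ c × ∀ i → ¬ target i ∈ c)
    search j with P ≟ₚ point j
    ... | yes P≡ = inj₁ (λ P≢ → contradiction P≡ P≢)
    ... | no  P≢ with join P (point j) P≢
    ... | c , P∈c , Z∈c , _ with any? (λ i → target i ∈? c)
    ... | yes (i , t∈c) = inj₁ (λ _ → i , c , P∈c , Z∈c , t∈c)
    ... | no  none      = inj₂ (c , P∈c , λ i t∈c → none (i , t∈c))
  ... | inj₂ found = found
  ... | inj₁ hits  = contradiction
    (transversals≤ P target P≢target (λ Z P≢Z → ≡.subst (λ Z → P ≢ Z → ∃ λ i → ∃ λ c → P ∈ c × Z ∈ c × target i ∈ c)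
      (point-number Z) (hits (number Z)) P≢Z))
    (ℕₚ.<⇒≱ few)

  -- Distinct blocks through `R` share only `R`, so their k q further points are distinct among the
  -- q³ points other than `R`.
  pencil≤ : ∀ {k} R (blk : Fin k → Block) → (∀ i → R ∈ blk i) → (∀ i j → blk i ≡ blk j → i ≡ j) → k ℕ.* q ℕ.≤ q ℕ.^ 3
  pencil≤ {k} R blk R∈ blk-inj = injective⇒≤ {f = uncurry f ∘ remQuot {k} q} (λ eq → remQuot-injective {k} q (f-injective eq))
    where
    Z : Fin k → Fin q → Point
    Z i j = member (blk i) (punchIn (position (blk i) (R∈ i)) j)
    R≢Z : ∀ i j → R ≢ Z i j
    R≢Z i j eq = punchInᵢ≢i (position (blk i) (R∈ i)) j
      (≡.sym (member-injective (blk i) (≡.trans (member-position (blk i) (R∈ i)) eq)))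
    number≢ : ∀ i j → number R ≢ number (Z i j)
    number≢ i j eq = R≢Z i j (number-injective eq)
    f : Fin k → Fin q → Fin (q ℕ.^ 3)
    f i j = punchOut (number≢ i j)
    f-injective : ∀ {x y} → uncurry f x ≡ uncurry f y → x ≡ y
    f-injective {i , j} {i′ , j′} eq = same-block (blk-inj i i′ (block-unique (R≢Z i j) (R∈ i) (member-∈ _ _) (R∈ i′)
        (≡.subst (_∈ blk i′) (≡.sym Z≡) (member-∈ _ _))))
      where
      Z≡ : Z i j ≡ Z i′ j′
      Z≡ = number-injective (punchOut-injective (number≢ i j) (number≢ i′ j′) eq)
      same-block : i ≡ i′ → (i , j) ≡ (i′ , j′)
      same-block ≡.refl = ≡.cong (i ,_) (punchIn-injective _ j j′ (member-injective (blk i) Z≡))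

  meets? : ∀ b c → Dec (∃ λ R → R ∈ b × R ∈ c)
  meets? b c = anyPoint? (λ R → R ∈? b ×-dec R ∈? c)

  both : Block → Block → Fin (suc q ℕ.+ suc q) → Point
  both b₁ b₂ k = [ member b₁ , member b₂ ]′ (splitAt (suc q) k)

  both-covers : ∀ b₁ b₂ {P} → P ∈ b₁ ⊎ P ∈ b₂ → ∃ λ k → both b₁ b₂ k ≡ P
  both-covers b₁ b₂ (inj₁ P∈b₁) = position b₁ P∈b₁ Fin.↑ˡ suc q ,
    ≡.trans (≡.cong [ member b₁ , member b₂ ]′ (splitAt-↑ˡ (suc q) _ (suc q))) (member-position b₁ P∈b₁)
  both-covers b₁ b₂ (inj₂ P∈b₂) = suc q Fin.↑ʳ position b₂ P∈b₂ ,
    ≡.trans (≡.cong [ member b₁ , member b₂ ]′ (splitAt-↑ʳ (suc q) (suc q) (position b₂ P∈b₂))) (member-position b₂ P∈b₂)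

  both-∈ : ∀ b₁ b₂ k → both b₁ b₂ k ∈ b₁ ⊎ both b₁ b₂ k ∈ b₂
  both-∈ b₁ b₂ k with splitAt (suc q) k
  ... | inj₁ i = inj₁ (member-∈ b₁ i)
  ... | inj₂ i = inj₂ (member-∈ b₂ i)

  outside-point : 2 ℕ.≤ q → ∀ b₁ b₂ → ∃ λ P → ¬ P ∈ b₁ × ¬ P ∈ b₂
  outside-point 2≤q b₁ b₂ with all-or search
    where
    search : ∀ i → (point i ∈ b₁ ⊎ point i ∈ b₂) ⊎ (∃ λ P → ¬ P ∈ b₁ × ¬ P ∈ b₂)
    search i with point i ∈? b₁ | point i ∈? b₂
    ... | yes ∈b₁ | _       = inj₁ (inj₁ ∈b₁)
    ... | no _    | yes ∈b₂ = inj₁ (inj₂ ∈b₂)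
    ... | no ∉b₁  | no ∉b₂  = inj₂ (point i , ∉b₁ , ∉b₂)
  ... | inj₂ found  = found
  ... | inj₁ inside = contradiction
    (covered⇒≤ point (both b₁ b₂) point-injective (λ i → both-covers b₁ b₂ (inside i)))
    (ℕₚ.<⇒≱ (2+2q<1+q³ 2≤q))

  -- For q = 2, two blocks through R missing b₁ and the three joining R to b₁
  -- would be five blocks through R, but there are only q² = 4.
  no-two-parallels : q ≡ 2 → ∀ {b b′ d R} → R ∈ b′ → R ∈ d → Disjoint b b′ → Disjoint b d → d ≢ b′ → ⊥
  no-two-parallels q≡2 {b} {b′} {d} {R} R∈b′ R∈d b∥b′ b∥d d≢b′ =
    contradiction (pencil≤ R blk R∈blk blk-injective) (ℕₚ.<⇒≱ (small q≡2))
    where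
    small : ∀ {q} → q ≡ 2 → q ℕ.^ 3 ℕ.< (2 ℕ.+ suc q) ℕ.* q
    small ≡.refl = ℕₚ.m<m+n 8 (s≤s z≤n)
    R≢ : ∀ i → R ≢ member b i
    R≢ i ≡.refl = b∥d R (member-∈ b i) R∈d
    spoke : ∀ i → ∃ λ c → R ∈ c × member b i ∈ c × _
    spoke i = join R (member b i) (R≢ i)
    blk : Fin (2 ℕ.+ suc q) → Block
    blk zero          = d
    blk (suc zero)    = b′
    blk (suc (suc i)) = proj₁ (spoke i)
    R∈blk : ∀ i → R ∈ blk i
    R∈blk zero          = R∈d
    R∈blk (suc zero)    = R∈b′
    R∈blk (suc (suc i)) = proj₁ (proj₂ (spoke i))
    ∈spoke : ∀ i → member b i ∈ proj₁ (spoke i)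
    ∈spoke i = proj₁ (proj₂ (proj₂ (spoke i)))
    spoke≢ : ∀ {c} i → Disjoint b c → proj₁ (spoke i) ≢ c
    spoke≢ i b∥c ≡.refl = b∥c _ (member-∈ b i) (∈spoke i)
    spoke-injective : ∀ i j → proj₁ (spoke i) ≡ proj₁ (spoke j) → i ≡ j
    spoke-injective i j eq with member b i ≟ₚ member b j
    ... | yes same = member-injective b same
    ... | no differ = ⊥-elim (b∥d R (≡.subst (R ∈_) (≡.sym b≡) (proj₁ (proj₂ (spoke i)))) R∈d)
      where
      b≡ : b ≡ proj₁ (spoke i)
      b≡ = block-unique differ (member-∈ b i) (member-∈ b j) (∈spoke i) (≡.subst (member b j ∈_) (≡.sym eq) (∈spoke j))
    blk-injective : ∀ i j → blk i ≡ blk j → i ≡ j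
    blk-injective zero          zero          _  = ≡.refl
    blk-injective zero          (suc zero)    eq = contradiction eq d≢b′
    blk-injective zero          (suc (suc j)) eq = contradiction (≡.sym eq) (spoke≢ j b∥d)
    blk-injective (suc zero)    zero          eq = contradiction (≡.sym eq) d≢b′
    blk-injective (suc zero)    (suc zero)    _  = ≡.refl
    blk-injective (suc zero)    (suc (suc j)) eq = contradiction (≡.sym eq) (spoke≢ j b∥b′)
    blk-injective (suc (suc i)) zero          eq = contradiction eq (spoke≢ i b∥d)
    blk-injective (suc (suc i)) (suc zero)    eq = contradiction eq (spoke≢ i b∥b′)
    blk-injective (suc (suc i)) (suc (suc j)) eq = ≡.cong (λ k → suc (suc k)) (spoke-injective i j eq)

  -- For q ≥ 3 the direct count suffices. For q = 2 a block `d` through `P` missing `b₁` also misses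
  -- `b₂`: a common point would lie on two blocks disjoint from `b₁`, and these differ because `P`
  -- is on `d` only.
  missing-block : 2 ℕ.≤ q → ∀ {b₁ b₂ P} → Disjoint b₁ b₂ → ¬ P ∈ b₁ → ¬ P ∈ b₂ →
    ∃ λ c → P ∈ c × Disjoint c b₁ × Disjoint c b₂
  missing-block 2≤q {b₁} {b₂} {P} b₁∥b₂ P∉b₁ P∉b₂ with q ℕₚ.≟ 2
  ... | no q≢2 with avoiding-block P (both b₁ b₂)
        (λ k P≡ → [ P∉b₁ , P∉b₂ ]′ (≡.subst (λ Z → Z ∈ b₁ ⊎ Z ∈ b₂) (≡.sym P≡) (both-∈ b₁ b₂ k)))
        ([2+2q]*q<q³ (ℕₚ.≤∧≢⇒< 2≤q (q≢2 ∘ ≡.sym)))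
  ... | c , P∈c , avoid = c , P∈c , (λ Z Z∈c Z∈b₁ → misses (inj₁ Z∈b₁) Z∈c) , (λ Z Z∈c Z∈b₂ → misses (inj₂ Z∈b₂) Z∈c)
    where
    misses : ∀ {Z} → Z ∈ b₁ ⊎ Z ∈ b₂ → ¬ Z ∈ c
    misses Z∈ Z∈c with both-covers b₁ b₂ Z∈
    ... | k , ≡.refl = avoid k Z∈c
  missing-block 2≤q {b₁} {b₂} {P} b₁∥b₂ P∉b₁ P∉b₂ | yes q≡2
    with avoiding-block P (member b₁) (λ i P≡ → P∉b₁ (≡.subst (_∈ b₁) (≡.sym P≡) (member-∈ b₁ i))) ([1+q]*q<q³ 2≤q)
  ... | d , P∈d , avoid = d , P∈d , (λ Z Z∈d Z∈b₁ → b₁∥d Z Z∈b₁ Z∈d) ,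
        (λ R R∈d R∈b₂ → no-two-parallels q≡2 R∈b₂ R∈d b₁∥b₂ b₁∥d (λ d≡b₂ → P∉b₂ (≡.subst (P ∈_) d≡b₂ P∈d)))
    where
    b₁∥d : Disjoint b₁ d
    b₁∥d Z Z∈b₁ Z∈d = avoid (position b₁ Z∈b₁) (≡.subst (_∈ d) (≡.sym (member-position b₁ Z∈b₁)) Z∈d)

  -- By uniqueness of joins the existential over blocks concerns a single block, and only the q + 1
  -- members of `b₁` need testing.
  full? : ∀ b₁ b₂ P → Dec (Full b₁ b₂ P)
  full? b₁ b₂ P with P ∈? b₁ | P ∈? b₂
  ... | yes P∈b₁ | _        = no (λ (P∉b₁ , _) → P∉b₁ P∈b₁)
  ... | no _     | yes P∈b₂ = no (λ (_ , P∉b₂ , _) → P∉b₂ P∈b₂)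
  ... | no P∉b₁  | no P∉b₂  = map′
    (λ reach → P∉b₁ , P∉b₂ , λ Q Q∈b₁ → ≡.subst Reaches (member-position b₁ Q∈b₁) (reach (position b₁ Q∈b₁)))
    (λ (_ , _ , reach) i → reach (member b₁ i) (member-∈ b₁ i))
    (all? (λ i → reaches? (member b₁ i) (member-∈ b₁ i)))
    where
    Reaches : Point → Set
    Reaches Q = ∃ λ c → P ∈ c × Q ∈ c × (∃ λ R → R ∈ b₂ × R ∈ c)
    reaches? : ∀ Q → Q ∈ b₁ → Dec (Reaches Q)
    reaches? Q Q∈b₁ with join P Q (∈∉⇒≢ Q∈b₁ P∉b₁ ∘ ≡.sym)
    ... | c , P∈c , Q∈c , unique = map′ (λ meet → c , P∈c , Q∈c , meet)
      (λ (d , P∈d , Q∈d , meet) → ≡.subst (λ c → ∃ λ R → R ∈ b₂ × R ∈ c) (unique d P∈d Q∈d) meet) (meets? b₂ c)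

-- Perspectivities

module Perspectivities {q : ℕ} (2≤q : 2 ℕ.≤ q) (F : CommutativeRing 0ℓ 0ℓ) (finite : IsFiniteFieldOfOrder (q ℕ.^ 2) F)
  (U : AbstractUnital q) (b₁ b₂ : AbstractUnital.Block U) (b₁∥b₂ : UnitalTheory.Disjoint U b₁ b₂)
  (coordinates : CoordinateChange.Frame F finite U b₁ b₂) where
  open CommutativeRing F hiding (zero)
  open IsFiniteFieldOfOrder finite
  open AbstractUnital U
  open UnitalTheory U
  open IntegerSolver F
  open FiniteField F finite
  open Counting U
  open CoordinateChange F finite using (module Frame)
  open Frame coordinates
  open Algebra.Properties.Ring ring using (+-cancelˡ; +-cancelʳ; -‿involutive; x∙y⁻¹≈ε⇒x≈y; -0#≈0#)
  open Algebra.Properties.CommutativeMonoid.Sum +-commutativeMonoid using (sum; sum-cong-≋; ∑-distrib-+; sum-permute; sum-replicate)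
  open Algebra.Properties.Semiring.Sum semiring using (*-distribˡ-sum)
  open Algebra.Properties.Semiring.Mult semiring using () renaming (_×_ to _·_)
  open Relation.Binary.Reasoning.Setoid setoid

  -- Affine coordinates and collinearity.

  X Y : Point → Carrier
  X x = γ x * β x ⁻¹
  Y z = γ z * α z ⁻¹

  β≉0 : ∀ {x} → x ∈ b₁ → ¬ β x ≈ 0#
  β≉0 x∈b₁ βx≈0 = b₁∥b₂ _ x∈b₁ (in-b₂ _ βx≈0)

  α≉0 : ∀ {z} → z ∈ b₂ → ¬ α z ≈ 0#
  α≉0 z∈b₂ αz≈0 = b₁∥b₂ _ (in-b₁ _ αz≈0) z∈b₂

  X*β≈γ : ∀ {x} → x ∈ b₁ → X x * β x ≈ γ x
  X*β≈γ {x} x∈b₁ = begin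
    γ x * β x ⁻¹ * β x    ≈⟨ *-assoc _ _ _ ⟩
    γ x * (β x ⁻¹ * β x)  ≈⟨ *-congˡ (trans (*-comm _ _) (⁻¹-inverseʳ (β≉0 x∈b₁))) ⟩
    γ x * 1#              ≈⟨ *-identityʳ _ ⟩
    γ x                   ∎

  Y*α≈γ : ∀ {z} → z ∈ b₂ → Y z * α z ≈ γ z
  Y*α≈γ {z} z∈b₂ = begin
    γ z * α z ⁻¹ * α z    ≈⟨ *-assoc _ _ _ ⟩
    γ z * (α z ⁻¹ * α z)  ≈⟨ *-congˡ (trans (*-comm _ _) (⁻¹-inverseʳ (α≉0 z∈b₂))) ⟩
    γ z * 1#              ≈⟨ *-identityʳ _ ⟩
    γ z                   ∎

  ratio-swap : ∀ {a b} → ¬ a ≈ 0# → b ≈ b * a ⁻¹ * a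
  ratio-swap {a} {b} a≉0 = sym (trans (*-assoc _ _ _) (trans (*-congˡ (trans (*-comm _ _) (⁻¹-inverseʳ a≉0))) (*-identityʳ b)))

  X-injective : ∀ {x y} → x ∈ b₁ → y ∈ b₁ → X x ≈ X y → x ≡ y
  X-injective {x} {y} x∈b₁ y∈b₁ eq = separates x y c (*-≉0 (β≉0 y∈b₁) (⁻¹-≉0 (β≉0 x∈b₁)))
    (trans (on-b₁ y y∈b₁) (sym (trans (*-congˡ (on-b₁ x x∈b₁)) (zeroʳ c))))
    (ratio-swap (β≉0 x∈b₁))
    (begin
      γ y               ≈⟨ X*β≈γ y∈b₁ ⟨
      X y * β y         ≈⟨ *-cong (sym eq) (ratio-swap (β≉0 x∈b₁)) ⟩
      X x * (c * β x)   ≈⟨ solve 3 (λ X c b → X :* (c :* b) := c :* (X :* b)) refl (X x) c (β x) ⟩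
      c * (X x * β x)   ≈⟨ *-congˡ (X*β≈γ x∈b₁) ⟩
      c * γ x           ∎)
    where c = β y * β x ⁻¹

  -- The equations of `c` at `z` and at `x` give k = -Y m and l = -X m. So m ≠ 0, as the line vector
  -- is nonzero, and after substitution m can be cancelled from the equation at `P`.
  collinear : ∀ {P x z c} → x ∈ b₁ → z ∈ b₂ → P ∈ c → x ∈ c → z ∈ c → α P * Y z + β P * X x ≈ γ P
  collinear {P} {x} {z} {c} x∈b₁ z∈b₂ P∈c x∈c z∈c with line c
  ... | k , l , m , klm≉0 , on-c = *-cancelˡ m≉0 (begin
      m * (α P * Y z + β P * X x)
        ≈⟨ solve 8 (λ a b g k l m X Y →
             m :* (a :* Y :+ b :* X) := (m :* g :- ((a :* k :+ b :* l) :+ g :* m)) :+ (a :* (k :+ Y :* m) :+ b :* (l :+ X :* m)))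
             refl (α P) (β P) (γ P) k l m (X x) (Y z) ⟩
      (m * γ P - ((α P * k + β P * l) + γ P * m)) + (α P * (k + Y z * m) + β P * (l + X x * m))
        ≈⟨ +-cong (+-congˡ (-‿cong (proj₁ (on-c P) P∈c))) (+-cong (*-congˡ k+Ym≈0) (*-congˡ l+Xm≈0)) ⟩
      (m * γ P - 0#) + (α P * 0# + β P * 0#)
        ≈⟨ +-cong (trans (+-congˡ -0#≈0#) (+-identityʳ _)) (trans (+-cong (zeroʳ _) (zeroʳ _)) (+-identityʳ 0#)) ⟩
      m * γ P + 0#
        ≈⟨ +-identityʳ _ ⟩
      m * γ P ∎)
    where
    k+Ym≈0 : k + Y z * m ≈ 0#
    k+Ym≈0 = x*y≈0⇒y≈0 (α≉0 z∈b₂) (begin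
      α z * (k + Y z * m)                ≈⟨ solve 4 (λ a k Y m → a :* (k :+ Y :* m) := a :* k :+ (Y :* a) :* m) refl (α z) k (Y z) m ⟩
      α z * k + (Y z * α z) * m          ≈⟨ +-cong (sym (trans (+-congˡ (trans (*-congʳ (on-b₂ z z∈b₂)) (zeroˡ l))) (+-identityʳ _))) (*-congʳ (Y*α≈γ z∈b₂)) ⟩
      (α z * k + β z * l) + γ z * m      ≈⟨ proj₁ (on-c z) z∈c ⟩
      0#                                 ∎)
    l+Xm≈0 : l + X x * m ≈ 0#
    l+Xm≈0 = x*y≈0⇒y≈0 (β≉0 x∈b₁) (begin
      β x * (l + X x * m)                ≈⟨ solve 4 (λ a k Y m → a :* (k :+ Y :* m) := a :* k :+ (Y :* a) :* m) refl (β x) l (X x) m ⟩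
      β x * l + (X x * β x) * m          ≈⟨ +-cong (sym (trans (+-congʳ (trans (*-congʳ (on-b₁ x x∈b₁)) (zeroˡ k))) (+-identityˡ _))) (*-congʳ (X*β≈γ x∈b₁)) ⟩
      (α x * k + β x * l) + γ x * m      ≈⟨ proj₁ (on-c x) x∈c ⟩
      0#                                 ∎)
    drop-m : ∀ {t s} → m ≈ 0# → t + s * m ≈ 0# → t ≈ 0#
    drop-m {t} {s} m≈0 eq = trans (sym (trans (+-congˡ (trans (*-congˡ m≈0) (zeroʳ s))) (+-identityʳ t))) eq
    -- Geometrically, `c` does not pass through N, which has coordinates (0, 0, 1).
    m≉0 : ¬ m ≈ 0#
    m≉0 m≈0 = klm≉0 (drop-m m≈0 k+Ym≈0 , drop-m m≈0 l+Xm≈0 , m≈0)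

  σ₁ σ₂ : Carrier
  σ₁ = sum (λ i → X (member b₁ i))
  σ₂ = sum (λ i → Y (member b₂ i))

  ξ η : Point → Carrier
  ξ x = X x - σ₁
  η z = Y z - σ₂

  -- Projection from full points.

  FullPoint : Point → Set
  FullPoint = Full b₁ b₂

  α-full≉0 : ∀ {P} → FullPoint P → ¬ α P ≈ 0#
  α-full≉0 (P∉b₁ , _) αP≈0 = P∉b₁ (in-b₁ _ αP≈0)

  β-full≉0 : ∀ {P} → FullPoint P → ¬ β P ≈ 0#
  β-full≉0 (_ , P∉b₂ , _) βP≈0 = P∉b₂ (in-b₂ _ βP≈0)

  project : ∀ {P} → FullPoint P → ∀ {x} → x ∈ b₁ → ∃ λ z → PerspMap b₁ P b₂ x z
  project (_ , _ , reach) x∈b₁ with reach _ x∈b₁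
  ... | c , P∈c , x∈c , z , z∈b₂ , z∈c = z , x∈b₁ , z∈b₂ , c , P∈c , x∈c , z∈c

  persp-equation : ∀ {P x z} → PerspMap b₁ P b₂ x z → α P * Y z + β P * X x ≈ γ P
  persp-equation (x∈b₁ , z∈b₂ , c , P∈c , x∈c , z∈c) = collinear x∈b₁ z∈b₂ P∈c x∈c z∈c

  module Projection {P} (full : FullPoint P) where
    image : Fin (suc q) → Point
    image i = proj₁ (project full (member-∈ b₁ i))

    persp : ∀ i → PerspMap b₁ P b₂ (member b₁ i) (image i)
    persp i = proj₂ (project full (member-∈ b₁ i))

    image-∈ : ∀ i → image i ∈ b₂
    image-∈ i = proj₁ (proj₂ (persp i))

    π : Fin (suc q) → Fin (suc q)
    π i = position b₂ (image-∈ i)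

    image-π : ∀ i → member b₂ (π i) ≡ image i
    image-π i = member-position b₂ (image-∈ i)

    π-injective : ∀ {i j} → π i ≡ π j → i ≡ j
    π-injective {i} {j} eq = member-injective b₁ (X-injective (member-∈ b₁ i) (member-∈ b₁ j)
      (*-cancelˡ (β-full≉0 full) (+-cancelˡ (α P * Y (image i)) _ _ (begin
        α P * Y (image i) + β P * X (member b₁ i)   ≈⟨ persp-equation (persp i) ⟩
        γ P                                         ≈⟨ persp-equation (persp j) ⟨
        α P * Y (image j) + β P * X (member b₁ j)   ≡⟨ ≡.cong (λ z → α P * Y z + β P * X (member b₁ j)) image≡ ⟨
        α P * Y (image i) + β P * X (member b₁ j)   ∎))))
      where
      image≡ : image i ≡ image j
      image≡ = ≡.trans (≡.sym (image-π i)) (≡.trans (≡.cong (member b₂) eq) (image-π j))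

    -- Summing the equations α Y + β X = γ over b₁; there are q + 1 of them and q = 0 in F.
    centre-equation : α P * σ₂ + β P * σ₁ ≈ γ P
    centre-equation = begin
      α P * σ₂ + β P * σ₁
        ≈⟨ +-congʳ (*-congˡ (sum-permute (λ i → Y (member b₂ i)) (injective⇒permutation π π-injective))) ⟩
      α P * sum (λ i → Y (member b₂ (π i))) + β P * σ₁
        ≈⟨ +-cong (*-distribˡ-sum (α P) (λ i → Y (member b₂ (π i)))) (*-distribˡ-sum (β P) (λ i → X (member b₁ i))) ⟩
      sum (λ i → α P * Y (member b₂ (π i))) + sum (λ i → β P * X (member b₁ i))
        ≈⟨ ∑-distrib-+ (λ i → α P * Y (member b₂ (π i))) (λ i → β P * X (member b₁ i)) ⟨
      sum (λ i → α P * Y (member b₂ (π i)) + β P * X (member b₁ i))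
        ≈⟨ sum-cong-≋ (λ i → trans (reflexive (≡.cong (λ z → α P * Y z + β P * X (member b₁ i)) (image-π i))) (persp-equation (persp i))) ⟩
      sum {suc q} (λ _ → γ P)
        ≈⟨ sum-replicate (suc q) ⟩
      γ P + q · γ P
        ≈⟨ trans (+-congˡ (√order·x≈0 q ≡.refl (γ P))) (+-identityʳ (γ P)) ⟩
      γ P ∎

    -- Fullness speaks only of blocks from `P` to points of `b₁`; the converse follows from
    -- injectivity because both blocks have q + 1 points.
    surjective : ∀ {z} → z ∈ b₂ → ∃ λ x → PerspMap b₁ P b₂ x z
    surjective {z} z∈b₂ = preimage (injective⇒surjective π π-injective (position b₂ z∈b₂))
      where
      preimage : (∃ λ i → π i ≡ position b₂ z∈b₂) → ∃ λ x → PerspMap b₁ P b₂ x z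
      preimage (i , eq) = member b₁ i , ≡.subst (PerspMap b₁ P b₂ (member b₁ i))
        (≡.trans (≡.sym (image-π i)) (≡.trans (≡.cong (member b₂) eq) (member-position b₂ z∈b₂))) (persp i)

  open Projection using (centre-equation; surjective)

  -- The factor by which the perspectivity with centre `P` multiplies in the shifted coordinates; it
  -- is also the parameter of `P` on the line of full points.
  slope : Point → Carrier
  slope P = - β P * α P ⁻¹

  slope≉0 : ∀ {P} → FullPoint P → ¬ slope P ≈ 0#
  slope≉0 {P} full = *-≉0 (λ eq → β-full≉0 full (trans (sym (-‿involutive (β P))) (trans (-‿cong eq) -0#≈0#))) (⁻¹-≉0 (α-full≉0 full))

  slope-α : ∀ {P} → FullPoint P → slope P * α P ≈ - β P
  slope-α full = sym (ratio-swap (α-full≉0 full))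

  -- Subtracting `centre-equation` from `persp-equation` removes γ and leaves α η + β ξ = 0.
  persp⇒slope : ∀ {P} → FullPoint P → ∀ {x z} → PerspMap b₁ P b₂ x z → η z ≈ slope P * ξ x
  persp⇒slope {P} full {x} {z} persp = *-cancelˡ (α-full≉0 full) (begin
    α P * (Y z - σ₂)
      ≈⟨ solve 6 (λ a b Y X s t → a :* (Y :- s) := ((a :* Y :+ b :* X) :- (a :* s :+ b :* t)) :+ (:- b) :* (X :- t))
           refl (α P) (β P) (Y z) (X x) σ₂ σ₁ ⟩
    ((α P * Y z + β P * X x) - (α P * σ₂ + β P * σ₁)) + - β P * (X x - σ₁)
      ≈⟨ +-cong (+-cong (persp-equation persp) (-‿cong (centre-equation full))) (*-congʳ (sym (slope-α full))) ⟩
    (γ P - γ P) + slope P * α P * ξ x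
      ≈⟨ solve 4 (λ g s a ξ → (g :- g) :+ s :* a :* ξ := a :* (s :* ξ)) refl (γ P) (slope P) (α P) (ξ x) ⟩
    α P * (slope P * ξ x) ∎)

  ξ-injective : ∀ {x y} → x ∈ b₁ → y ∈ b₁ → ξ x ≈ ξ y → x ≡ y
  ξ-injective x∈b₁ y∈b₁ eq = X-injective x∈b₁ y∈b₁ (+-cancelʳ _ _ _ eq)

  persp-sym : ∀ {a b P x z} → PerspMap a P b x z → PerspMap b P a z x
  persp-sym (x∈a , z∈b , c , P∈c , x∈c , z∈c) = z∈b , x∈a , c , P∈c , z∈c , x∈c

  -- For a full point, γ is determined by α and β, so the ratio of β to α already fixes the point.
  slope-injective : ∀ {P Q} → FullPoint P → FullPoint Q → slope P ≈ slope Q → P ≡ Q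
  slope-injective {P} {Q} fullP fullQ eq = separates P Q c (*-≉0 (α-full≉0 fullQ) (⁻¹-≉0 (α-full≉0 fullP))) eα eβ (begin
    γ Q                             ≈⟨ centre-equation fullQ ⟨
    α Q * σ₂ + β Q * σ₁             ≈⟨ +-cong (*-congʳ eα) (*-congʳ eβ) ⟩
    c * α P * σ₂ + c * β P * σ₁     ≈⟨ solve 5 (λ c a b s t → c :* a :* s :+ c :* b :* t := c :* (a :* s :+ b :* t)) refl c (α P) (β P) σ₂ σ₁ ⟩
    c * (α P * σ₂ + β P * σ₁)       ≈⟨ *-congˡ (centre-equation fullP) ⟩
    c * γ P                         ∎)
    where
    c = α Q * α P ⁻¹
    eα : α Q ≈ c * α P
    eα = ratio-swap (α-full≉0 fullP)
    eβ : β Q ≈ c * β P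
    eβ = begin
      β Q                       ≈⟨ -‿involutive _ ⟨
      - - β Q                   ≈⟨ -‿cong (slope-α fullQ) ⟨
      - (slope Q * α Q)         ≈⟨ -‿cong (*-cong (sym eq) eα) ⟩
      - (slope P * (c * α P))   ≈⟨ solve 3 (λ s c a → :- (s :* (c :* a)) := c :* (:- (s :* a))) refl (slope P) c (α P) ⟩
      c * - (slope P * α P)     ≈⟨ *-congˡ (-‿cong (slope-α fullP)) ⟩
      c * - - β P               ≈⟨ *-congˡ (-‿involutive _) ⟩
      c * β P                   ∎

  -- Words as multiplications.

  Stable : Carrier → Set
  Stable s = ∀ {x} → x ∈ b₁ → ∃ λ y → y ∈ b₁ × ξ y ≈ s * ξ x

  -- Says that `f` is the graph of multiplication by `s` on `b₁` in the coordinate ξ. Composition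
  -- needs `stable` to produce the middle point when proving `complete`.
  record Acts (f : Rel) (s : Carrier) : Set where
    field
      nonzero  : ¬ s ≈ 0#
      stable   : Stable s
      sound    : ∀ {x y} → f x y → x ∈ b₁ × y ∈ b₁ × ξ y ≈ s * ξ x
      complete : ∀ {x y} → x ∈ b₁ → y ∈ b₁ → ξ y ≈ s * ξ x → f x y
  open Acts

  acts-unique : ∀ {f g s t} → Acts f s → Acts g t → s ≈ t → f ≐ g
  acts-unique F G s≈t x y =
    (λ fxy → let x∈b₁ , y∈b₁ , eq = sound F fxy in complete G x∈b₁ y∈b₁ (trans eq (*-congʳ s≈t))) ,
    (λ gxy → let x∈b₁ , y∈b₁ , eq = sound G gxy in complete F x∈b₁ y∈b₁ (trans eq (*-congʳ (sym s≈t))))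

  acts-id : Acts (IdOn b₁) 1#
  acts-id = record
    { nonzero  = λ eq → 0≉1 (sym eq)
    ; stable   = λ {x} x∈b₁ → x , x∈b₁ , sym (*-identityˡ _)
    ; sound    = λ { (x∈b₁ , ≡.refl) → x∈b₁ , x∈b₁ , sym (*-identityˡ _) }
    ; complete = λ x∈b₁ y∈b₁ eq → x∈b₁ , ξ-injective x∈b₁ y∈b₁ (sym (trans eq (*-identityˡ _))) }

  acts-⨾ : ∀ {f g s t} → Acts f s → Acts g t → Acts (f ⨾ g) (s * t)
  acts-⨾ {f} {g} {s} {t} F G = record
    { nonzero  = *-≉0 (nonzero F) (nonzero G)
    ; stable   = λ x∈b₁ → let w , w∈b₁ , eq = stable F x∈b₁ ; y , y∈b₁ , eq′ = stable G w∈b₁ in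
        y , y∈b₁ , compose eq eq′
    ; sound    = λ (w , fxw , gwy) → let x∈b₁ , _ , eq = sound F fxw ; _ , y∈b₁ , eq′ = sound G gwy in
        x∈b₁ , y∈b₁ , compose eq eq′
    ; complete = λ x∈b₁ y∈b₁ eq → let w , w∈b₁ , eq′ = stable F x∈b₁ in
        w , complete F x∈b₁ w∈b₁ eq′ , complete G w∈b₁ y∈b₁ (trans eq (sym (compose eq′ refl))) }
    where
    compose : ∀ {a b c} → b ≈ s * a → c ≈ t * b → c ≈ s * t * a
    compose {a} eq eq′ = trans eq′ (trans (*-congˡ eq)
      (solve 3 (λ s t a → t :* (s :* a) := s :* t :* a) refl s t a))

  multiplier : Point → Point → Carrier
  multiplier P Q = slope P * slope Q ⁻¹

  -- The way out through `P` multiplies by `slope P`, the way back through `Q` divides by `slope Q`.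
  -- For `complete`, the given `y` is identified with the actual image of `x` by `ξ-injective`.
  acts-generator : ∀ P Q → Acts (Gen b₁ b₂ P Q) (multiplier (proj₁ P) (proj₁ Q))
  acts-generator (P , fullP) (Q , fullQ) = record
    { nonzero  = *-≉0 (slope≉0 fullP) (⁻¹-≉0 (slope≉0 fullQ))
    ; stable   = stable′
    ; sound    = λ (w , persp@(x∈b₁ , _) , persp′@(_ , y∈b₁ , _)) →
        x∈b₁ , y∈b₁ , through⇒multiplier persp (persp-sym persp′)
    ; complete = complete′ }
    where
    divide-slope : ∀ {a b} → slope P * a ≈ slope Q * b → b ≈ multiplier P Q * a
    divide-slope {a} {b} eq = *-cancelˡ (slope≉0 fullQ) (begin
      slope Q * b                             ≈⟨ eq ⟨
      slope P * a                             ≈⟨ *-identityˡ _ ⟨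
      1# * (slope P * a)                      ≈⟨ *-congʳ (⁻¹-inverseʳ (slope≉0 fullQ)) ⟨
      slope Q * slope Q ⁻¹ * (slope P * a)    ≈⟨ solve 4 (λ t t′ s a → t :* t′ :* (s :* a) := t :* (s :* t′ :* a)) refl (slope Q) (slope Q ⁻¹) (slope P) a ⟩
      slope Q * (multiplier P Q * a)          ∎)
    through : ∀ {x} → x ∈ b₁ → ∃ λ w → ∃ λ y → PerspMap b₁ P b₂ x w × PerspMap b₁ Q b₂ y w
    through x∈b₁ = let w , persp = project fullP x∈b₁ ; y , persp′ = surjective fullQ (proj₁ (proj₂ persp)) in
      w , y , persp , persp′
    through⇒multiplier : ∀ {x y w} → PerspMap b₁ P b₂ x w → PerspMap b₁ Q b₂ y w → ξ y ≈ multiplier P Q * ξ x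
    through⇒multiplier persp persp′ = divide-slope (trans (sym (persp⇒slope fullP persp)) (persp⇒slope fullQ persp′))
    stable′ : Stable (multiplier P Q)
    stable′ x∈b₁ = let w , y , persp , persp′ = through x∈b₁ in
      y , proj₁ persp′ , through⇒multiplier persp persp′
    complete′ : ∀ {x y} → x ∈ b₁ → y ∈ b₁ → ξ y ≈ multiplier P Q * ξ x → Gen b₁ b₂ (P , fullP) (Q , fullQ) x y
    complete′ x∈b₁ y∈b₁ eq = let w , y′ , persp , persp′ = through x∈b₁ in
      w , persp , persp-sym (≡.subst (λ y → PerspMap b₁ Q b₂ y w)
        (ξ-injective (proj₁ persp′) y∈b₁ (trans (through⇒multiplier persp persp′) (sym eq))) persp′)

  -- A multiplication by s with a fixed point ξ = 0 in b₁ permutes the remaining q points of b₁,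
  -- so s^q = 1, while s^(q²) = s.
  stable-with-centre : ∀ {s x} → ¬ s ≈ 0# → Stable s → x ∈ b₁ → ξ x ≈ 0# → s ≈ 1#
  stable-with-centre {s} {x} s≉0 stable-s x∈b₁ ξx≈0 = begin
    s                       ≈⟨ fermat s≉0 ⟨
    s ^ (q ℕ.* (q ℕ.* 1))   ≈⟨ ^-assocʳ s q (q ℕ.* 1) ⟨
    (s ^ q) ^ (q ℕ.* 1)     ≈⟨ ^-congˡ (q ℕ.* 1) s^q≈1 ⟩
    1# ^ (q ℕ.* 1)          ≈⟨ 1^k≈1 (q ℕ.* 1) ⟩
    1#                      ∎
    where
    φ : Fin (suc q) → Fin (suc q)
    φ i = position b₁ (proj₁ (proj₂ (stable-s (member-∈ b₁ i))))
    s^q≈1 : s ^ q ≈ 1#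
    s^q≈1 = scaling-order (λ i → ξ (member b₁ i))
      (λ i j eq → member-injective b₁ (ξ-injective (member-∈ b₁ i) (member-∈ b₁ j) eq))
      {position b₁ x∈b₁} (trans (reflexive (≡.cong ξ (member-position b₁ x∈b₁))) ξx≈0) s≉0 φ
      (λ i → trans (reflexive (≡.cong ξ (member-position b₁ (proj₁ (proj₂ (stable-s (member-∈ b₁ i)))))))
        (proj₂ (proj₂ (stable-s (member-∈ b₁ i)))))

  -- Semi-regularity and cyclicity.

  weight : Word b₁ b₂ → Carrier
  weight []            = 1#
  weight ((P , Q) ∷ w) = multiplier (proj₁ P) (proj₁ Q) * weight w

  acts-word : ∀ w → Acts (⟦_⟧ b₁ b₂ w) (weight w)
  acts-word []            = acts-id
  acts-word ((P , Q) ∷ w) = acts-⨾ (acts-generator P Q) (acts-word w)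

  acts-power : ∀ {f s} → Acts f s → ∀ n → Acts (_^^_ b₁ b₂ f n) (s ^ n)
  acts-power F zero    = acts-id
  acts-power F (suc n) = acts-⨾ F (acts-power F n)

  -- At a fixed point with ξ ≠ 0 the coordinate cancels. Every multiplication fixes ξ = 0, so there
  -- the conclusion rests on `stable-with-centre`.
  semiregular : PerspSemiRegular b₁ b₂
  semiregular w x x∈b₁ wxx = acts-unique W acts-id weight≈1
    where
    W = acts-word w
    weight≈1 : weight w ≈ 1#
    weight≈1 with ξ x ≟ 0#
    ... | yes ξx≈0 = stable-with-centre (nonzero W) (stable W) x∈b₁ ξx≈0
    ... | no  ξx≉0 = *-cancelˡ ξx≉0 (begin
      ξ x * weight w   ≈⟨ *-comm _ _ ⟩
      weight w * ξ x   ≈⟨ proj₂ (proj₂ (sound W wxx)) ⟨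
      ξ x              ≈⟨ *-identityʳ _ ⟨
      ξ x * 1#         ∎)

  -- Weights are closed under products, and a word is determined as a permutation by its weight. The
  -- element supplied by `cyclic` is the weight of some word `v`, so every word acts as a power of
  -- `v`.
  cyclic-perspectivities : PerspCyclic b₁ b₂
  cyclic-perspectivities = finish (cyclic IsWeight ([] , refl) IsWeight-* generator generator-weight generator≉0)
    where
    IsWeight : Carrier → Set
    IsWeight s = ∃ λ w → weight w ≈ s
    weight-++ : ∀ v w → weight (v ++ w) ≈ weight v * weight w
    weight-++ []            w = sym (*-identityˡ _)
    weight-++ ((P , Q) ∷ v) w = trans (*-congˡ (weight-++ v w)) (sym (*-assoc _ _ _))
    IsWeight-* : ∀ {s t} → IsWeight s → IsWeight t → IsWeight (s * t)
    IsWeight-* (v , eq) (w , eq′) = v ++ w , trans (weight-++ v w) (*-cong eq eq′)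
    pair : Point → Point → Carrier
    pair P Q with full? b₁ b₂ P ×-dec full? b₁ b₂ Q
    ... | yes _ = multiplier P Q
    -- The default 1 is the weight of the empty word, so the family can run over all pairs of points
    -- and still consist of weights.
    ... | no  _ = 1#
    -- `multiplier` sees only the points, so the proof of fullness carried by a word may differ from
    -- the one found by `full?`.
    pair-full : ∀ {P Q} → FullPoint P → FullPoint Q → pair P Q ≈ multiplier P Q
    pair-full {P} {Q} fullP fullQ with full? b₁ b₂ P ×-dec full? b₁ b₂ Q
    ... | yes _   = refl
    ... | no ¬pq = contradiction (fullP , fullQ) ¬pq
    pair-weight : ∀ P Q → IsWeight (pair P Q)
    pair-weight P Q with full? b₁ b₂ P ×-dec full? b₁ b₂ Q
    ... | yes (fullP , fullQ) = (((P , fullP) , (Q , fullQ)) ∷ []) , *-identityʳ _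
    ... | no  _               = [] , refl
    number-of-points : ℕ
    number-of-points = suc (q ℕ.^ 3)
    generator : Fin (number-of-points ℕ.* number-of-points) → Carrier
    generator i = let j , k = remQuot {number-of-points} number-of-points i in pair (point j) (point k)
    generator-weight : ∀ i → IsWeight (generator i)
    generator-weight i = pair-weight _ _
    generator≉0 : ∀ i → ¬ generator i ≈ 0#
    generator≉0 i eq with generator-weight i
    ... | w , weq = nonzero (acts-word w) (trans weq eq)
    generator-pair : ∀ P Q → generator (combine (number P) (number Q)) ≡ pair P Q
    generator-pair P Q = ≡.trans
      (≡.cong (λ (j , k) → pair (point j) (point k)) (remQuot-combine (number P) (number Q)))
      (≡.cong₂ pair (point-number P) (point-number Q))
    finish : (∃ λ g → IsWeight g × ∀ i → ∃ λ e → generator i ≈ g ^ e) → PerspCyclic b₁ b₂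
    finish (g , (v , v≈g) , powers) = v , λ w → let e , eq = exponent w in
      e , acts-unique (acts-word w) (acts-power (acts-word v) e) (trans eq (^-congˡ e (sym v≈g)))
      where
      exponent : ∀ w → ∃ λ e → weight w ≈ g ^ e
      exponent [] = 0 , refl
      exponent (((P , fullP) , (Q , fullQ)) ∷ w) with exponent w | powers (combine (number P) (number Q))
      ... | e , eq | d , eq′ = d ℕ.+ e , (begin
        multiplier P Q * weight w   ≈⟨ *-cong (trans (sym (pair-full fullP fullQ)) (trans (reflexive (≡.sym (generator-pair P Q))) eq′)) eq ⟩
        g ^ d * g ^ e               ≈⟨ ^-homo-* g d e ⟨
        g ^ (d ℕ.+ e)               ∎)

  -- The block that contains the full points.

  module TwoFullPoints {P Q} (fullP : FullPoint P) (fullQ : FullPoint Q) (P≢Q : P ≢ Q) where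
    private
      c : Block
      c = proj₁ (join P Q P≢Q)
      P∈c : P ∈ c
      P∈c = proj₁ (proj₂ (join P Q P≢Q))
      Q∈c : Q ∈ c
      Q∈c = proj₁ (proj₂ (proj₂ (join P Q P≢Q)))
      slopes-differ : ¬ slope P ≈ slope Q
      slopes-differ eq = P≢Q (slope-injective fullP fullQ eq)

    -- At a common point `x`, the block `c` joins `x` to both centres, so `P` and `Q` project `x` to
    -- the same `z` and the two slopes agree on ξ x. If ξ x ≠ 0 they are equal; if ξ x = 0,
    -- `stable-with-centre` makes their quotient 1. But distinct full points have distinct slopes.
    c∥b₁ : Disjoint c b₁
    c∥b₁ x x∈c x∈b₁ with project fullP x∈b₁
    ... | z , persp@(_ , z∈b₂ , d , P∈d , x∈d , z∈d) = slopes-differ (slopes-agree (ξ x ≟ 0#))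
      where
      c≡d : d ≡ c
      c≡d = block-unique (λ P≡x → proj₁ fullP (≡.subst (_∈ b₁) (≡.sym P≡x) x∈b₁)) P∈d x∈d P∈c x∈c
      same-image : slope P * ξ x ≈ slope Q * ξ x
      same-image = trans (sym (persp⇒slope fullP persp))
        (persp⇒slope fullQ (x∈b₁ , z∈b₂ , c , Q∈c , x∈c , ≡.subst (z ∈_) c≡d z∈d))
      slopes-agree : Dec (ξ x ≈ 0#) → slope P ≈ slope Q
      slopes-agree (no ξx≉0)  = *-cancelˡ ξx≉0 (trans (*-comm _ _) (trans same-image (*-comm _ _)))
      slopes-agree (yes ξx≈0) = begin
        slope P                  ≈⟨ ratio-swap (slope≉0 fullQ) ⟩
        multiplier P Q * slope Q ≈⟨ *-congʳ (stable-with-centre (nonzero G) (stable G) x∈b₁ ξx≈0) ⟩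
        1# * slope Q             ≈⟨ *-identityˡ _ ⟩
        slope Q                  ∎
        where G = acts-generator (P , fullP) (Q , fullQ)

    -- A point `z` of `c` on `b₂` is the image of some `x` in `b₁` under projection from `P`; the
    -- block through `P` and `z` is `c`, so `x` would lie on `c`.
    c∥b₂ : Disjoint c b₂
    c∥b₂ z z∈c z∈b₂ = let x , x∈b₁ , _ , d , P∈d , x∈d , z∈d = surjective fullP z∈b₂ in
      c∥b₁ x (≡.subst (x ∈_) (block-unique P≢z P∈d z∈d P∈c z∈c) x∈d) x∈b₁
      where
      P≢z : P ≢ z
      P≢z P≡z = proj₁ (proj₂ fullP) (≡.subst (_∈ b₂) (≡.sym P≡z) z∈b₂)

    -- For full points, γ = α σ₂ + β σ₁ turns the equation of `c` into α (K - slope L) = 0, which is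
    -- affine in the slope. The different slopes of `P` and `Q` both satisfy it, so K = L = 0 and
    -- every full point does.
    c-contains : ∀ R → FullPoint R → R ∈ c
    c-contains R fullR with line c
    ... | k , l , m , _ , on-c = proj₂ (on-c R) (trans (reduced fullR) (trans (*-congˡ K-sL≈0) (zeroʳ _)))
      where
      K L : Carrier
      K = k + σ₂ * m
      L = l + σ₁ * m
      reduced : ∀ {R} → FullPoint R → (α R * k + β R * l) + γ R * m ≈ α R * (K - slope R * L)
      reduced {R} fullR = begin
        (α R * k + β R * l) + γ R * m                        ≈⟨ +-congˡ (*-congʳ (centre-equation fullR)) ⟨
        (α R * k + β R * l) + (α R * σ₂ + β R * σ₁) * m      ≈⟨ solve 7 (λ a b k l m s t →
          (a :* k :+ b :* l) :+ (a :* s :+ b :* t) :* m := a :* (k :+ s :* m) :- (:- b) :* (l :+ t :* m)) refl (α R) (β R) k l m σ₂ σ₁ ⟩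
        α R * K - - β R * L                                  ≈⟨ +-congˡ (-‿cong (*-congʳ (slope-α fullR))) ⟨
        α R * K - slope R * α R * L                          ≈⟨ solve 4 (λ a s K L → a :* K :- s :* a :* L := a :* (K :- s :* L)) refl (α R) (slope R) K L ⟩
        α R * (K - slope R * L)                              ∎
      K≈sL : ∀ {R} → FullPoint R → R ∈ c → K ≈ slope R * L
      K≈sL {R} fullR R∈c = x∙y⁻¹≈ε⇒x≈y _ _ (x*y≈0⇒y≈0 (α-full≉0 fullR) (trans (sym (reduced fullR)) (proj₁ (on-c R) R∈c)))
      L≈0 : L ≈ 0#
      L≈0 = x*y≈0⇒y≈0 (λ eq → slopes-differ (x∙y⁻¹≈ε⇒x≈y _ _ eq)) (begin
        (slope P - slope Q) * L          ≈⟨ solve 3 (λ s t L → (s :- t) :* L := s :* L :- t :* L) refl (slope P) (slope Q) L ⟩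
        slope P * L - slope Q * L        ≈⟨ +-cong (K≈sL fullP P∈c) (-‿cong (K≈sL fullQ Q∈c)) ⟨
        K - K                            ≈⟨ -‿inverseʳ K ⟩
        0#                               ∎)
      K≈0 : K ≈ 0#
      K≈0 = trans (K≈sL fullP P∈c) (trans (*-congˡ L≈0) (zeroʳ _))
      K-sL≈0 : K - slope R * L ≈ 0#
      K-sL≈0 = begin
        K - slope R * L      ≈⟨ +-cong K≈0 (-‿cong (trans (*-congˡ L≈0) (zeroʳ _))) ⟩
        0# - 0#              ≈⟨ -‿inverseʳ 0# ⟩
        0#                   ∎

    block : ∃ λ c → Disjoint c b₁ × Disjoint c b₂ × (∀ R → FullPoint R → R ∈ c)
    block = c , c∥b₁ , c∥b₂ , c-contains

  full-points-in-block : ∃ λ c → Disjoint c b₁ × Disjoint c b₂ × (∀ P → FullPoint P → P ∈ c)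
  full-points-in-block with anyPoint? (full? b₁ b₂)
  -- Without full points any block missing both will do; the outside point only serves to find one.
  ... | no none with outside-point 2≤q b₁ b₂
  ... | P , P∉b₁ , P∉b₂ with missing-block 2≤q b₁∥b₂ P∉b₁ P∉b₂
  ... | c , _ , c∥b₁ , c∥b₂ = c , c∥b₁ , c∥b₂ , λ R fullR → contradiction (R , fullR) none
  full-points-in-block | yes (P , fullP) with anyPoint? (λ Q → full? b₁ b₂ Q ×-dec ¬? (P ≟ₚ Q))
  ... | yes (Q , fullQ , P≢Q) = TwoFullPoints.block fullP fullQ P≢Q
  -- With a single full point, the missing block is taken through that point.
  ... | no only with missing-block 2≤q b₁∥b₂ (proj₁ fullP) (proj₁ (proj₂ fullP))
  ... | c , P∈c , c∥b₁ , c∥b₂ = c , c∥b₁ , c∥b₂ , contains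
    where
    contains : ∀ R → FullPoint R → R ∈ c
    contains R fullR with P ≟ₚ R
    ... | yes P≡R = ≡.subst (_∈ c) P≡R P∈c
    ... | no  P≢R = contradiction (R , fullR , P≢R) only

prime-power≥2 : ∀ {q} → IsPrimePower q → 2 ℕ.≤ q
prime-power≥2 (p , k , pr , ≡.refl) = ℕₚ.≤-trans (ℕ.nonTrivial⇒n>1 p {{prime⇒nonTrivial pr}})
  (ℕₚ.m≤m*n p (p ℕ.^ k) {{ℕₚ.m^n≢0 p k {{prime⇒nonZero pr}}}})

open import Data.Nat using (ℕ; _^_)

theorem3p6 : (q : ℕ) → IsPrimePower q →
    (F : CommutativeRing 0ℓ 0ℓ) → IsFiniteFieldOfOrder (q ^ 2) F →
    (U : AbstractUnital q) → EmbeddedIn U F →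
    UnitalTheory.StronglyFullPointRegular U
theorem3p6 q prime-power F finite U E b₁ b₂ b₁∥b₂ = full-points-in-block , cyclic-perspectivities , semiregular
  where
  open Counting U using (member; member-∈)
  open Perspectivities (prime-power≥2 prime-power) F finite U b₁ b₂ b₁∥b₂
    (CoordinateChange.frame F finite U E (member b₁ zero , member-∈ b₁ zero) b₁∥b₂)
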